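{- Let $T$ be a trigraph in the class $\mathcal F$ that contains no antihole, such that $T$ is either the complement of a bipartite trigraph or the complement of a line trigraph. Then: (1) $T$ is either complete or has an even pair; (2) if $T$ is favorable, then $T$ has an even pair disjoint from its switchable component.
   Context: A trigraph $T$ consists of a finite set $V(T)$ and a map $\theta:\binom{V(T)}{2}\to\{ -1,0,1\}$. Distinct $u,v$ are strongly adjacent if $\theta(uv)=1$, strongly antiadjacent if $\theta(uv)=-1$, semiadjacent (a switchable pair) if $\theta(uv)=0$; adjacent if $\theta(uv)\in\{0,1\}$, antiadjacent if $\theta(uv)\in\{0,-1\}$. $N(v)$ is the set of vertices adjacent to $v$. The complement $\overline T$ has adjacency $-\theta$. $T|X$ is the restriction to $X$, $T\setminus X=T|(V(T)\setminus X)$; $T$ contains $H$ if $H$ is isomorphic to some $T|X$. A clique (strong clique) is a set of pairwise adjacent (strongly adjacent) vertices; $T$ is complete if $V(T)$ is a clique; a strongly stable set is a set of pairwise strongly antiadjacent vertices. The full realization is the graph whose edges are the adjacent pairs. $T$ is bipartite if $V(T)$ can be partitioned into two strongly stable sets; $T$ is a line trigraph if its full realization is the line graph of a bipartite graph and every clique of size at least $3$ is a strong clique. A path is a sequence $p_1,\dots,p_k$ of distinct vertices with $p_i,p_j$ adjacent when $|i-j|=1$ and antiadjacent when $|i-j|>1$; length $k-1$. A hole is a sequence $h_1,\dots,h_k$ ($k\ge5$) with cyclically consecutive vertices adjacent and other pairs antiadjacent; an antihole is an induced subtrigraph whose complement is a hole in $\overline T$. $T$ is Berge if it has no odd hole and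 no odd antihole. An even pair is a strongly antiadjacent pair $\{u,v\}$ such that every path from $u$ to $v$ has even length. $\Sigma(T)$ is the graph on $V(T)$ whose edges are the switchable pairs; a switchable component is a component of $\Sigma(T)$ with at least two vertices. $\mathcal F$ is the class of Berge trigraphs with at most one switchable component, having at most two edges, such that if it has one edge $xy$ then $N(x)\cap N(y)=\emptyset$ (small), and if it has two edges $vx,vy$ then $v$ is strongly antiadjacent to all vertices outside $\{v,x,y\}$, $x,y$ are strongly antiadjacent and $N(x)\cap N(y)=\{v\}$ (light). $D$ denotes the vertex set of the switchable component ($\emptyset$ if none); a pair is disjoint from the switchable component if it does not meet $D$. $T\in\mathcal F$ is favorable if $|V(T)|\ge5$, $T$ has a strongly antiadjacent pair disjoint from $D$, and, if $D=\{x,y\}$ is small, at least one of $T\setminus(D\cup N(x))$, $T\setminus(D\cup N(y))$ is not a clique. -}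

module Defs where

open import Data.Nat using (ℕ; zero; suc; _+_; _≤_; _∸_)
open import Data.Nat.Properties using ()
open import Data.Fin using (Fin; toℕ; fromℕ)
import Data.Fin as Fin
open import Data.Unit using (⊤)
open import Data.Fin.Subset using (Subset; _∈_; ∣_∣)
open import Data.Product using (Σ; ∃; _×_; _,_; proj₁; proj₂)
open import Data.Sum using (_⊎_)
open import Data.Bool using (Bool)
open import Data.Empty using (⊥)
open import Relation.Nullary using (¬_)
open import Relation.Binary.PropositionalEquality using (_≡_; _≢_)
open import Function.Definitions using (Injective)

Even : ℕ → Set
Even k = Σ ℕ λ m → k ≡ m + m

Odd : ℕ → Set
Odd k = Σ ℕ λ m → k ≡ suc (m + m)

data Θ : Set where
  plus zer minus : Θ

neg : Θ → Θ
neg plus = minus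
neg zer = zer
neg minus = plus

-- A trigraph on vertex set Fin n; θ is symmetric, its diagonal is irrelevant.
record Trigraph : Set where
  field
    n   : ℕ
    θ   : Fin n → Fin n → Θ
    sym : ∀ u v → θ u v ≡ θ v u
open Trigraph public

V : Trigraph → Set
V T = Fin (n T)

complement : Trigraph → Trigraph
complement T = record { n = n T ; θ = λ u v → neg (θ T u v) ; sym = λ u v → cong′ (sym T u v) }
  where
  cong′ : ∀ {a b} → a ≡ b → neg a ≡ neg b
  cong′ Relation.Binary.PropositionalEquality.refl = Relation.Binary.PropositionalEquality.refl

module _ (T : Trigraph) where
  StronglyAdj : V T → V T → Set
  StronglyAdj u v = θ T u v ≡ plus
  StronglyAnti : V T → V T → Set
  StronglyAnti u v = θ T u v ≡ minus
  Semi : V T → V T → Set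
  Semi u v = u ≢ v × θ T u v ≡ zer
  Adjacent : V T → V T → Set
  Adjacent u v = u ≢ v × (θ T u v ≡ plus ⊎ θ T u v ≡ zer)
  Antiadjacent : V T → V T → Set
  Antiadjacent u v = u ≢ v × (θ T u v ≡ minus ⊎ θ T u v ≡ zer)

  InN : V T → V T → Set
  InN v w = Adjacent v w

  IsPath : (k : ℕ) → (Fin (suc k) → V T) → Set
  IsPath k p = Injective _≡_ _≡_ p
             × (∀ i j → suc (toℕ i) ≡ toℕ j → Adjacent (p i) (p j))
             × (∀ i j → 2 + toℕ i ≤ toℕ j → Antiadjacent (p i) (p j))

  CycNb : ℕ → ℕ → ℕ → Set
  CycNb k i j = suc i ≡ j ⊎ suc j ≡ i ⊎ (i ≡ 0 × suc j ≡ k) ⊎ (j ≡ 0 × suc i ≡ k)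

  IsHole : (k : ℕ) → (Fin k → V T) → Set
  IsHole k h = 5 ≤ k × Injective _≡_ _≡_ h
             × (∀ i j → CycNb k (toℕ i) (toℕ j) → Adjacent (h i) (h j))
             × (∀ i j → i ≢ j → ¬ CycNb k (toℕ i) (toℕ j) → Antiadjacent (h i) (h j))

  HasOddHole : Set
  HasOddHole = Σ ℕ λ k → Σ (Fin k → V T) λ h → IsHole k h × Odd k

IsAntihole : (T : Trigraph) → (k : ℕ) → (Fin k → V T) → Set
IsAntihole T k h = IsHole (complement T) k h

HasAntihole : Trigraph → Set
HasAntihole T = Σ ℕ λ k → Σ (Fin k → V T) λ h → IsAntihole T k h

HasOddAntihole : Trigraph → Set
HasOddAntihole T = HasOddHole (complement T)

Berge : Trigraph → Set
Berge T = ¬ HasOddHole T × ¬ HasOddAntihole T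

module _ (T : Trigraph) where
  IsClique : Subset (n T) → Set
  IsClique X = ∀ u v → u ∈ X → v ∈ X → u ≢ v → Adjacent T u v

  IsStrongClique : Subset (n T) → Set
  IsStrongClique X = ∀ u v → u ∈ X → v ∈ X → u ≢ v → StronglyAdj T u v

  Complete : Set
  Complete = ∀ u v → u ≢ v → Adjacent T u v

  IsBipartite : Set
  IsBipartite = Σ (V T → Bool) λ f → ∀ u v → u ≢ v → f u ≡ f v → StronglyAnti T u v

  -- full realization is the line graph of a (simple) bipartite graph with
  -- sides Fin a, Fin b: vertex u of T corresponds to the edge e u, and the
  -- map e is a bijection onto the edge set (its image).
  FullRealizationIsLineGraphOfBipartite : Set
  FullRealizationIsLineGraphOfBipartite =
    Σ ℕ λ a → Σ ℕ λ b → Σ (V T → Fin a × Fin b) λ e →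
      Injective _≡_ _≡_ e
      × (∀ u v → u ≢ v →
          (Adjacent T u v → (proj₁ (e u) ≡ proj₁ (e v) ⊎ proj₂ (e u) ≡ proj₂ (e v)))
        × ((proj₁ (e u) ≡ proj₁ (e v) ⊎ proj₂ (e u) ≡ proj₂ (e v)) → Adjacent T u v))

  IsLineTrigraph : Set
  IsLineTrigraph = FullRealizationIsLineGraphOfBipartite
                 × (∀ X → 3 ≤ ∣ X ∣ → IsClique X → IsStrongClique X)

  IsEvenPair : V T → V T → Set
  IsEvenPair u v = u ≢ v × StronglyAnti T u v
    × (∀ k (p : Fin (suc k) → V T) → IsPath T k p → p Fin.zero ≡ u → p (fromℕ k) ≡ v → Even k)

  HasEvenPair : Set
  HasEvenPair = Σ (V T) λ u → Σ (V T) λ v → IsEvenPair u v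

-- Description of the switchable components (Σ(T)) of a trigraph in 𝓕:
-- none, a single small edge xy, or a light component with edges vx, vy.
data SwComp (T : Trigraph) : Set where
  none  : SwComp T
  small : V T → V T → SwComp T
  light : V T → V T → V T → SwComp T

InD : {T : Trigraph} → SwComp T → V T → Set
InD none w = ⊥
InD (small x y) w = w ≡ x ⊎ w ≡ y
InD (light v x y) w = w ≡ v ⊎ w ≡ x ⊎ w ≡ y

Describes : (T : Trigraph) → SwComp T → Set
Describes T none = ∀ u w → ¬ Semi T u w
Describes T (small x y) =
    Semi T x y
  × (∀ u w → Semi T u w → (u ≡ x × w ≡ y) ⊎ (u ≡ y × w ≡ x))
  × (∀ w → ¬ (InN T x w × InN T y w))
Describes T (light v x y) =
    x ≢ y × Semi T v x × Semi T v y
  × (∀ u w → Semi T u w →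
       (u ≡ v × w ≡ x) ⊎ (u ≡ x × w ≡ v) ⊎ (u ≡ v × w ≡ y) ⊎ (u ≡ y × w ≡ v))
  × (∀ w → w ≢ v → w ≢ x → w ≢ y → StronglyAnti T v w)
  × StronglyAnti T x y
  × (∀ w → InN T x w × InN T y w → w ≡ v)

InF : (T : Trigraph) → SwComp T → Set
InF T s = Berge T × Describes T s

Favorable : (T : Trigraph) → SwComp T → Set
Favorable T s =
    5 ≤ n T
  × (Σ (V T) λ u → Σ (V T) λ w → u ≢ w × StronglyAnti T u w × ¬ InD s u × ¬ InD s w)
  × SmallCond s
  where
  NotCliqueOutside : SwComp T → V T → Set
  NotCliqueOutside s z = Σ (V T) λ u → Σ (V T) λ w →
      ¬ InD s u × ¬ InD s w × ¬ InN T z u × ¬ InN T z w × u ≢ w × ¬ Adjacent T u w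
  SmallCond : SwComp T → Set
  SmallCond (small x y) = NotCliqueOutside (small x y) x ⊎ NotCliqueOutside (small x y) y
  SmallCond _ = ⊤

{-# OPTIONS --safe #-}
-- In the complement H of T the light component is impossible, and an even pair of T is a strongly
-- adjacent pair of H on which no P₄ of T is supported: T has no P₆, hence no longer odd path.
-- If H is bipartite without switchable pair, a bisimplicial edge of H is an even pair; such an edge
-- is read off a doubly lexical order of the bipartite adjacency matrix.  If H is a line trigraph
-- without switchable pair, the first two vertices of a longest induced path of H are an even pair.
-- With a small component xy, every other vertex is strongly adjacent in H to x or to y, which makes
-- the neighbourhoods on one side nested (H bipartite) or leaves no room for a P₄ (H line trigraph).

module Submission where

open import Defs hiding (sym)
open import Data.Nat using (ℕ; zero; suc; _+_; _*_; _^_; _≤_; _<_; z≤n; s≤s)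
open import Data.Nat.Properties
open import Data.Bool using (Bool; true; false; not)
import Data.Bool.Properties as Boolₚ
open import Data.Fin using (Fin; zero; suc; toℕ; fromℕ; inject≤)
import Data.Fin.Properties as Finₚ
open import Data.Fin.Subset using (Subset; _∈_; _∪_; ⁅_⁆; ∣_∣)
open import Data.Fin.Subset.Properties using (p⊂q⇒∣p∣<∣q∣; q⊆p∪q; x∈p∪q⁺; x∈p∪q⁻; x∈⁅x⁆; x∈⁅y⁆⇒x≡y; ∣⁅x⁆∣≡1)
open import Data.Vec using (tabulate)
open import Data.Vec.Properties using (lookup∘tabulate; lookup⇒[]=; []=⇒lookup)
open import Data.List using (List; []; _∷_; _++_; [_]; length; lookup; filter; allFin)
open import Data.List.Properties using (length-++)
open import Data.List.Relation.Unary.All as All using (All; []; _∷_)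
import Data.List.Relation.Unary.All.Properties as Allₚ
open import Data.List.Relation.Binary.Permutation.Propositional using (_↭_; ↭-refl; ↭-sym; ↭-trans; ↭-prep; ↭-swap)
open import Data.List.Relation.Binary.Permutation.Propositional.Properties using (↭-length; All-resp-↭; ∈-resp-↭)
open import Data.List.Relation.Unary.AllPairs using (AllPairs; []; _∷_)
open import Data.List.Relation.Unary.Linked using (Linked; []; [-]; _∷_)
open import Data.List.Relation.Unary.Linked.Properties using (Linked⇒AllPairs)
open import Data.List.Membership.Propositional using () renaming (_∈_ to _∈ˡ_)
open import Data.List.Membership.Propositional.Properties using (∈-lookup; ∈-filter⁺; ∈-allFin)
open import Data.List.Relation.Unary.Any using (index)
open import Data.List.Relation.Unary.Any.Properties using (lookup-index)
open import Data.Nat.Tactic.RingSolver using (solve-∀)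
open import Data.Product using (Σ; ∃; _×_; _,_; proj₁; proj₂; swap)
open import Data.Sum as Sum using (_⊎_; inj₁; inj₂)
open import Data.Empty using (⊥; ⊥-elim)
open import Function using (_∘_; flip)
open import Function.Definitions using (Injective)
open import Relation.Nullary using (¬_; Dec; yes; no; ¬?; _×-dec_; _⊎-dec_; does)
open import Relation.Nullary.Decidable using (dec-true)
open import Relation.Binary using (tri<; tri≈; tri>)
open import Relation.Binary.PropositionalEquality using (_≡_; _≢_; refl; sym; trans; cong; cong₂; subst; subst₂; ≢-sym)

-- Seen in H, a P₄ `u`, `a`, `b`, `v` of T over a strongly antiadjacent pair `u`, `v` is an induced
-- path `b`, `u`, `v`, `a` whose middle edge is `uv`. What is sought is thus an edge of H that is in
-- the middle of no induced P₄; for bipartite H these are the bisimplicial edges. Having no antihole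
-- in T forbids the holes of H, but 4-cycles remain, and they are the obstacle: a path prolonged at
-- an end may run back into itself through a 4-cycle without any contradiction. For bipartite H a
-- fixed order of rows and columns controls this, since the earliest distinguishing row or column
-- meets the path only at its end. For a line trigraph the absence of claws does it: the path can be
-- led through the fourth vertex of the 4-cycle.

-- Induced paths and cycles as lists, and the holes they give.

module InducedPaths {A : Set} (Adj Non : A → A → Set) where

  data Path : A → List A → Set where
    stop : ∀ {x} → Path x []
    step : ∀ {x y zs} → Adj x y → All (Non x) zs → Path y zs → Path x (y ∷ zs)

  -- Cut open at `w`, a cycle is an induced path, the form in which the constructions below deliver
  -- it. Two vertices in `ys` make its length at least 5.
  record Cycle : Set where
    constructor cycle
    field
      {w x z}  : A
      {ys}     : List A
      long     : 2 ≤ length ys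
      start    : Adj w x
      chordless : All (Non w) ys
      end      : Adj w z
      path     : Path x (ys ++ [ z ])

  path-take : ∀ {x z zs} ys → Path x (ys ++ z ∷ zs) → Path x (ys ++ [ z ])
  path-take [] (step a ns p) = step a [] stop
  path-take (y ∷ ys) (step a ns p) =
    step a (Allₚ.++⁺ (Allₚ.++⁻ˡ ys ns) (All.head (Allₚ.++⁻ʳ ys ns) ∷ [])) (path-take ys p)

  path-snoc : ∀ {x z w} ys → Path x (ys ++ [ z ]) → Non x w → All (λ y → Non y w) ys → Adj z w →
    Path x ((ys ++ [ z ]) ++ [ w ])
  path-snoc [] (step a [] p) n [] a′ = step a (n ∷ []) (step a′ [] stop)
  path-snoc (y ∷ ys) (step a ns p) n (m ∷ ms) a′ =
    step a (Allₚ.++⁺ ns (n ∷ [])) (path-snoc ys p m ms a′)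

  path-pairs : ∀ {x xs} → Path x xs → (i j : Fin (suc (length xs))) → toℕ i < toℕ j →
      (suc (toℕ i) ≡ toℕ j × Adj (lookup (x ∷ xs) i) (lookup (x ∷ xs) j))
    ⊎ (suc (suc (toℕ i)) ≤ toℕ j × Non (lookup (x ∷ xs) i) (lookup (x ∷ xs) j))
  path-pairs (step a ns p) zero (suc zero) _ = inj₁ (refl , a)
  path-pairs (step a ns p) zero (suc (suc j)) _ = inj₂ (s≤s (s≤s z≤n) , All.lookup ns (∈-lookup j))
  path-pairs (step a ns p) (suc i) (suc j) (s≤s i<j) =
    Sum.map (λ (e , q) → cong suc e , q) (λ (l , q) → s≤s l , q) (path-pairs p i j i<j)

  apex-pairs : ∀ {w z} ys → All (Non w) ys → Adj w z → (j : Fin (length (ys ++ [ z ]))) →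
      (suc (toℕ j) ≡ length (ys ++ [ z ]) × Adj w (lookup (ys ++ [ z ]) j))
    ⊎ (suc (suc (toℕ j)) ≤ length (ys ++ [ z ]) × Non w (lookup (ys ++ [ z ]) j))
  apex-pairs [] [] a zero = inj₁ (refl , a)
  apex-pairs {z = z} (y ∷ ys) (n ∷ ns) a zero = inj₂ (s≤s (nonempty ys) , n)
    where
    nonempty : ∀ ys → 1 ≤ length (ys ++ [ z ])
    nonempty [] = s≤s z≤n
    nonempty (_ ∷ _) = s≤s z≤n
  apex-pairs (y ∷ ys) (n ∷ ns) a (suc j) =
    Sum.map (λ (e , q) → cong suc e , q) (λ (l , q) → s≤s l , q) (apex-pairs ys ns a j)

module _ (T : Trigraph) where
  open InducedPaths (Adjacent T) (Antiadjacent T)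

  adjacent-sym : ∀ {u v} → Adjacent T u v → Adjacent T v u
  adjacent-sym {u} {v} (u≢v , a) = ≢-sym u≢v , subst (λ t → t ≡ plus ⊎ t ≡ zer) (Trigraph.sym T u v) a

  antiadjacent-sym : ∀ {u v} → Antiadjacent T u v → Antiadjacent T v u
  antiadjacent-sym {u} {v} (u≢v , a) = ≢-sym u≢v , subst (λ t → t ≡ minus ⊎ t ≡ zer) (Trigraph.sym T u v) a

  path-length : ∀ {x xs} → Path x xs → suc (length xs) ≤ n T
  path-length {x} {xs} p = Finₚ.injective⇒≤ injective
    where
    distinct : ∀ i j → toℕ i < toℕ j → lookup (x ∷ xs) i ≢ lookup (x ∷ xs) j
    distinct i j i<j with path-pairs p i j i<j
    ... | inj₁ (_ , a) = proj₁ a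
    ... | inj₂ (_ , a) = proj₁ a
    injective : Injective _≡_ _≡_ (lookup (x ∷ xs))
    injective {i} {j} e with <-cmp (toℕ i) (toℕ j)
    ... | tri< i<j _ _ = ⊥-elim (distinct i j i<j e)
    ... | tri≈ _ i≡j _ = Finₚ.toℕ-injective i≡j
    ... | tri> _ _ j<i = ⊥-elim (distinct j i j<i (sym e))

  cycle⇒hole : Cycle → Σ ℕ λ k → Σ (Fin k → V T) λ h → IsHole T k h
  cycle⇒hole (cycle {w} {x} {z} {ys} long start chordless end path) =
    k , h , 5≤k , injective , adjacent , antiadjacent
    where
    k : ℕ
    k = suc (suc (length (ys ++ [ z ])))

    h : Fin k → V T
    h = lookup (w ∷ x ∷ ys ++ [ z ])

    5≤k : 5 ≤ k
    5≤k rewrite length-++ ys {[ z ]} | +-comm (length ys) 1 = s≤s (s≤s (s≤s long))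

    pairs : ∀ i j → toℕ i < toℕ j →
        (CycNb T k (toℕ i) (toℕ j) × Adjacent T (h i) (h j))
      ⊎ (¬ CycNb T k (toℕ i) (toℕ j) × Antiadjacent T (h i) (h j))
    pairs zero (suc zero) _ = inj₁ (inj₁ refl , start)
    pairs zero (suc (suc j)) _ with apex-pairs ys chordless end j
    ... | inj₁ (e , a) = inj₁ (inj₂ (inj₂ (inj₁ (refl , cong (λ l → suc (suc l)) e))) , a)
    ... | inj₂ (l , a) = inj₂ (¬nb , a)
      where
      ¬nb : ¬ CycNb T k 0 (suc (suc (toℕ j)))
      ¬nb (inj₁ ())
      ¬nb (inj₂ (inj₁ ()))
      ¬nb (inj₂ (inj₂ (inj₁ (_ , e)))) = <-irrefl (suc-injective (suc-injective e)) l
      ¬nb (inj₂ (inj₂ (inj₂ (() , _))))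
    pairs (suc i) (suc j) (s≤s i<j) with path-pairs path i j i<j
    ... | inj₁ (e , a) = inj₁ (inj₁ (cong suc e) , a)
    ... | inj₂ (l , a) = inj₂ (¬nb , a)
      where
      ¬nb : ¬ CycNb T k (suc (toℕ i)) (suc (toℕ j))
      ¬nb (inj₁ e) = <-irrefl (suc-injective e) l
      ¬nb (inj₂ (inj₁ e)) = <-asym i<j (≤-reflexive (suc-injective e))
      ¬nb (inj₂ (inj₂ (inj₁ (() , _))))
      ¬nb (inj₂ (inj₂ (inj₂ (() , _))))

    cycNb-sym : ∀ {i j} → CycNb T k i j → CycNb T k j i
    cycNb-sym (inj₁ e) = inj₂ (inj₁ e)
    cycNb-sym (inj₂ (inj₁ e)) = inj₁ e
    cycNb-sym (inj₂ (inj₂ (inj₁ e))) = inj₂ (inj₂ (inj₂ e))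
    cycNb-sym (inj₂ (inj₂ (inj₂ e))) = inj₂ (inj₂ (inj₁ e))

    cycNb-irrefl : ∀ {i} → ¬ CycNb T k i i
    cycNb-irrefl (inj₁ e) = 1+n≢n e
    cycNb-irrefl (inj₂ (inj₁ e)) = 1+n≢n e
    cycNb-irrefl (inj₂ (inj₂ (inj₁ (refl , ()))))
    cycNb-irrefl (inj₂ (inj₂ (inj₂ (refl , ()))))

    distinct : ∀ i j → toℕ i < toℕ j → h i ≢ h j
    distinct i j i<j with pairs i j i<j
    ... | inj₁ (_ , a) = proj₁ a
    ... | inj₂ (_ , a) = proj₁ a

    injective : Injective _≡_ _≡_ h
    injective {i} {j} e with <-cmp (toℕ i) (toℕ j)
    ... | tri< i<j _ _ = ⊥-elim (distinct i j i<j e)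
    ... | tri≈ _ i≡j _ = Finₚ.toℕ-injective i≡j
    ... | tri> _ _ j<i = ⊥-elim (distinct j i j<i (sym e))

    adjacent : ∀ i j → CycNb T k (toℕ i) (toℕ j) → Adjacent T (h i) (h j)
    adjacent i j c with <-cmp (toℕ i) (toℕ j)
    ... | tri≈ _ i≡j _ = ⊥-elim (cycNb-irrefl (subst (CycNb T k (toℕ i)) (sym i≡j) c))
    ... | tri< i<j _ _ with pairs i j i<j
    ...   | inj₁ (_ , a) = a
    ...   | inj₂ (¬c , _) = ⊥-elim (¬c c)
    adjacent i j c | tri> _ _ j<i with pairs j i j<i
    ...   | inj₁ (_ , a) = adjacent-sym a
    ...   | inj₂ (¬c , _) = ⊥-elim (¬c (cycNb-sym c))

    antiadjacent : ∀ i j → i ≢ j → ¬ CycNb T k (toℕ i) (toℕ j) → Antiadjacent T (h i) (h j)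
    antiadjacent i j i≢j ¬c with <-cmp (toℕ i) (toℕ j)
    ... | tri≈ _ i≡j _ = ⊥-elim (i≢j (Finₚ.toℕ-injective i≡j))
    ... | tri< i<j _ _ with pairs i j i<j
    ...   | inj₁ (c , _) = ⊥-elim (¬c c)
    ...   | inj₂ (_ , a) = a
    antiadjacent i j i≢j ¬c | tri> _ _ j<i with pairs j i j<i
    ...   | inj₁ (c , _) = ⊥-elim (¬c (cycNb-sym c))
    ...   | inj₂ (_ , a) = antiadjacent-sym a

-- Binary weights and doubly lexical orders.

module _ {A : Set} where

  -- On bits this is the value of a binary numeral whose head is the most significant digit.
  -- Arbitrary values are allowed so that the weights of rows can be weighed again.
  weigh : (A → ℕ) → List A → ℕ
  weigh f [] = 0
  weigh f (x ∷ xs) = 2 ^ length xs * f x + weigh f xs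

  -- The powers of two add up to `2 ^ length xs` minus one. The summand `K` on the left avoids the
  -- subtraction and makes the bound strict for bits.
  weigh-bound : ∀ {f K} → (∀ x → f x ≤ K) → ∀ xs → weigh f xs + K ≤ 2 ^ length xs * K
  weigh-bound {f} {K} f≤K [] = ≤-reflexive (sym (+-identityʳ K))
  weigh-bound {f} {K} f≤K (x ∷ xs) = begin
    2 ^ length xs * f x + weigh f xs + K    ≡⟨ +-assoc (2 ^ length xs * f x) _ K ⟩
    2 ^ length xs * f x + (weigh f xs + K)  ≤⟨ +-mono-≤ (*-monoʳ-≤ (2 ^ length xs) (f≤K x)) (weigh-bound f≤K xs) ⟩
    2 ^ length xs * K + 2 ^ length xs * K   ≡⟨ double (2 ^ length xs) K ⟩
    2 * 2 ^ length xs * K                   ∎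
    where
    open ≤-Reasoning
    double : ∀ p k → p * k + p * k ≡ 2 * p * k
    double = solve-∀

  weigh-zero : ∀ xs → weigh (λ _ → 0) xs ≡ 0
  weigh-zero [] = refl
  weigh-zero (x ∷ xs) rewrite *-zeroʳ (2 ^ length xs) = weigh-zero xs

  weigh-linear : ∀ p (f g : A → ℕ) xs → weigh (λ x → p * f x + g x) xs ≡ p * weigh f xs + weigh g xs
  weigh-linear p f g [] rewrite *-zeroʳ p = refl
  weigh-linear p f g (x ∷ xs) rewrite weigh-linear p f g xs =
    regroup (2 ^ length xs) p (f x) (g x) (weigh f xs) (weigh g xs)
    where
    regroup : ∀ q p a b c d → q * (p * a + b) + (p * c + d) ≡ p * (q * a + c) + (q * b + d)
    regroup = solve-∀

  ordered-or-improvable : ∀ (f : A → ℕ) xs →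
    Linked (λ x y → f y ≤ f x) xs ⊎ ∃ λ ys → ys ↭ xs × weigh f xs < weigh f ys
  ordered-or-improvable f [] = inj₁ []
  ordered-or-improvable f (x ∷ []) = inj₁ [-]
  ordered-or-improvable f (x ∷ y ∷ zs) with f y ≤? f x | ordered-or-improvable f (y ∷ zs)
  ... | no ¬le | _ = inj₂ (y ∷ x ∷ zs , ↭-swap y x ↭-refl , swap-increases (≰⇒> ¬le))
    where
    p = 2 ^ length zs
    regroup : ∀ p a b w → 2 * p * a + (p * b + w) ≡ p * a + (p * a + p * b + w)
    regroup = solve-∀
    regroup′ : ∀ p a b w → 2 * p * b + (p * a + w) ≡ p * b + (p * a + p * b + w)
    regroup′ = solve-∀
    swap-increases : f x < f y → weigh f (x ∷ y ∷ zs) < weigh f (y ∷ x ∷ zs)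
    swap-increases lt rewrite regroup p (f x) (f y) (weigh f zs) | regroup′ p (f x) (f y) (weigh f zs) =
      +-monoˡ-< _ (*-monoʳ-< p {{m^n≢0 2 (length zs)}} lt)
  ... | yes le | inj₁ l = inj₁ (le ∷ l)
  ... | yes le | inj₂ (ys , ↭ , lt) = inj₂ (x ∷ ys , ↭-prep x ↭ , increases)
    where
    increases : weigh f (x ∷ y ∷ zs) < weigh f (x ∷ ys)
    increases rewrite ↭-length ↭ = +-monoʳ-< (2 ^ length (y ∷ zs) * f x) lt

-- Exchanging the order of summation lets an exchange of columns be seen to raise the same total as
-- an exchange of rows.
weigh-comm : ∀ {A B : Set} (m : A → B → ℕ) xs ys →
  weigh (λ x → weigh (m x) ys) xs ≡ weigh (λ y → weigh (flip m y) xs) ys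
weigh-comm m xs [] = weigh-zero xs
weigh-comm m xs (y ∷ ys) = trans
  (weigh-linear (2 ^ length ys) (flip m y) (λ x → weigh (m x) ys) xs)
  (cong (2 ^ length ys * weigh (flip m y) xs +_) (weigh-comm m xs ys))

bit : Bool → ℕ
bit false = 0
bit true  = 1

bit≤1 : ∀ b → bit b ≤ 1
bit≤1 false = z≤n
bit≤1 true  = s≤s z≤n

-- The larger of two binary numerals has the 1 where they first differ. At `j` the 1 is on the other
-- side, so the first difference comes earlier.
first-difference : ∀ {A : Set} (f g : A → Bool) xs → weigh (bit ∘ f) xs ≤ weigh (bit ∘ g) xs →
  ∀ j → f (lookup xs j) ≡ true → g (lookup xs j) ≡ false →
  ∃ λ j* → toℕ j* < toℕ j × f (lookup xs j*) ≡ false × g (lookup xs j*) ≡ true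
    × (∀ c → toℕ c < toℕ j* → f (lookup xs c) ≡ g (lookup xs c))
first-difference f g (x ∷ xs) le j fj gj with f x in fx | g x in gx
first-difference f g (x ∷ xs) le zero fj gj | false | true with () ← trans (sym fx) fj
first-difference f g (x ∷ xs) le (suc j) fj gj | false | true = zero , s≤s z≤n , fx , gx , λ _ ()
-- A leading 1 against a leading 0 outweighs all later digits together, contrary to `le`.
first-difference f g (x ∷ xs) le j fj gj | true | false = ⊥-elim (<-irrefl refl (begin-strict
  2 ^ length xs * 0 + weigh (bit ∘ g) xs       ≡⟨ cong (_+ weigh (bit ∘ g) xs) (*-zeroʳ (2 ^ length xs)) ⟩
  weigh (bit ∘ g) xs                           <⟨ ≤-reflexive (+-comm 1 _) ⟩
  weigh (bit ∘ g) xs + 1                       ≤⟨ weigh-bound (bit≤1 ∘ g) xs ⟩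
  2 ^ length xs * 1                            ≤⟨ m≤m+n _ _ ⟩
  2 ^ length xs * 1 + weigh (bit ∘ f) xs       ≤⟨ le ⟩
  2 ^ length xs * 0 + weigh (bit ∘ g) xs       ∎))
  where
  open ≤-Reasoning
first-difference f g (x ∷ xs) le zero fj gj | false | false with () ← trans (sym fx) fj
first-difference f g (x ∷ xs) le zero fj gj | true | true with () ← trans (sym gx) gj
first-difference f g (x ∷ xs) le (suc j) fj gj | false | false
  with j* , lt , e , e′ , agree ← first-difference f g xs (+-cancelˡ-≤ (2 ^ length xs * 0) _ _ le) j fj gj
  = suc j* , s≤s lt , e , e′ , λ { zero _ → trans fx (sym gx) ; (suc c) (s≤s lt) → agree c lt }
first-difference f g (x ∷ xs) le (suc j) fj gj | true | true
  with j* , lt , e , e′ , agree ← first-difference f g xs (+-cancelˡ-≤ (2 ^ length xs * 1) _ _ le) j fj gj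
  = suc j* , s≤s lt , e , e′ , λ { zero _ → trans fx (sym gx) ; (suc c) (s≤s lt) → agree c lt }

-- Row 0 and column 0 are the most significant.
Lexical : ∀ {p q} → (Fin p → Fin q → Bool) → Set
Lexical M = ∀ {i i′} → toℕ i < toℕ i′ → ∀ {j} → M i′ j ≡ true → M i j ≡ false →
  ∃ λ j* → toℕ j* < toℕ j × M i′ j* ≡ false × M i j* ≡ true
    × (∀ c → toℕ c < toℕ j* → M i′ c ≡ M i c)

DoublyLexical : ∀ {p q} → (Fin p → Fin q → Bool) → Set
DoublyLexical M = Lexical M × Lexical (flip M)

submatrix : ∀ {A B : Set} → (A → B → Bool) → (xs : List A) (ys : List B) → Fin (length xs) → Fin (length ys) → Bool
submatrix m xs ys i j = m (lookup xs i) (lookup ys j)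

AllPairs-lookup : ∀ {A : Set} {R : A → A → Set} {xs} → AllPairs R xs →
  ∀ i j → toℕ i < toℕ j → R (lookup xs i) (lookup xs j)
AllPairs-lookup (rs ∷ _) zero (suc j) _ = All.lookup rs (∈-lookup j)
AllPairs-lookup (_ ∷ ps) (suc i) (suc j) (s≤s lt) = AllPairs-lookup ps i j lt

ordered⇒lexical : ∀ {A B : Set} (m : A → B → Bool) xs ys →
  Linked (λ x x′ → weigh (bit ∘ m x′) ys ≤ weigh (bit ∘ m x) ys) xs → Lexical (submatrix m xs ys)
ordered⇒lexical m xs ys l {i} {i′} lt {j} =
  first-difference _ _ ys (AllPairs-lookup (Linked⇒AllPairs (flip ≤-trans) l) i i′ lt) j

-- An order maximising ∑ 2^(row weight) 2^(column weight) m is doubly lexical: exchanging two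
-- consecutive rows (or columns) that are out of order increases the sum.
doublyLexical-reordering : ∀ {A B : Set} (m : A → B → Bool) xs ys →
  ∃ λ xs′ → ∃ λ ys′ → xs′ ↭ xs × ys′ ↭ ys × DoublyLexical (submatrix m xs′ ys′)
doublyLexical-reordering {A} {B} m xs ys = climb (bound xs ys) xs ys (m≤n+m _ _)
  where
  total : List A → List B → ℕ
  total xs ys = weigh (λ x → weigh (bit ∘ m x) ys) xs

  bound : List A → List B → ℕ
  bound xs ys = 2 ^ length xs * 2 ^ length ys

  total≤bound : ∀ xs ys → total xs ys ≤ bound xs ys
  total≤bound xs ys = ≤-trans (m≤m+n _ _) (weigh-bound row≤ xs)
    where
    row≤ : ∀ x → weigh (bit ∘ m x) ys ≤ 2 ^ length ys
    row≤ x = ≤-trans (m≤m+n _ 1) (≤-trans (weigh-bound (bit≤1 ∘ m x) ys) (≤-reflexive (*-identityʳ _)))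

  -- `d` is an upper bound for what the total can still gain; each exchange uses up at least one
  -- unit of it.
  climb : ∀ d xs ys → bound xs ys ≤ total xs ys + d →
    ∃ λ xs′ → ∃ λ ys′ → xs′ ↭ xs × ys′ ↭ ys × DoublyLexical (submatrix m xs′ ys′)

  reclimb : ∀ d xs ys xs⁺ ys⁺ → xs⁺ ↭ xs → ys⁺ ↭ ys → total xs ys < total xs⁺ ys⁺ →
    bound xs ys ≤ total xs ys + d →
    ∃ λ xs′ → ∃ λ ys′ → xs′ ↭ xs × ys′ ↭ ys × DoublyLexical (submatrix m xs′ ys′)
  reclimb d xs ys xs⁺ ys⁺ p q lt b with bound⁺ ← total≤bound xs⁺ ys⁺ rewrite sym (↭-length p) | sym (↭-length q) with d
  ... | zero = ⊥-elim (<-irrefl refl (<-≤-trans lt (≤-trans bound⁺ (≤-trans b (≤-reflexive (+-identityʳ _))))))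
  ... | suc d with xs′ , ys′ , p′ , q′ , l ← climb d xs⁺ ys⁺ (≤-trans b (≤-trans (≤-reflexive (+-suc _ d)) (+-monoˡ-≤ d lt)))
    = xs′ , ys′ , ↭-trans p′ p , ↭-trans q′ q , l

  climb d xs ys b
    with ordered-or-improvable (λ x → weigh (bit ∘ m x) ys) xs
       | ordered-or-improvable (λ y → weigh (bit ∘ flip m y) xs) ys
  ... | inj₁ l | inj₁ l′ = xs , ys , ↭-refl , ↭-refl , ordered⇒lexical m xs ys l , ordered⇒lexical (flip m) ys xs l′
  ... | inj₂ (xs⁺ , p , lt) | _ = reclimb d xs ys xs⁺ ys p ↭-refl lt b
  ... | inj₁ _ | inj₂ (ys⁺ , q , lt) = reclimb d xs ys xs ys⁺ ↭-refl q
    (≤-trans (s≤s (≤-reflexive (weigh-comm (λ x → bit ∘ m x) xs ys)))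
      (≤-trans lt (≤-reflexive (sym (weigh-comm (λ x → bit ∘ m x) xs ys⁺))))) b

-- Chordal bipartite graphs and bisimplicial edges.

module ChordalBipartite {V : Set} (Adj Non : V → V → Set)
  (Adj-sym : ∀ {u v} → Adj u v → Adj v u) (Non-sym : ∀ {u v} → Non u v → Non v u) where

  open InducedPaths Adj Non

  -- `rows` and `cols` concern only vertices that the matrix tells apart. This provides their
  -- distinctness without a proof that the lists behind the matrix are free of repetitions.
  record Represents {p q} (M : Fin p → Fin q → Bool) (ρ : Fin p → V) (κ : Fin q → V) : Set where
    field
      adj  : ∀ {i j} → M i j ≡ true → Adj (ρ i) (κ j)
      non  : ∀ {i j} → M i j ≡ false → Non (ρ i) (κ j)
      rows : ∀ {i i′ j} → M i j ≡ true → M i′ j ≡ false → Non (ρ i) (ρ i′)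
      cols : ∀ {i j j′} → M i j ≡ true → M i j′ ≡ false → Non (κ j) (κ j′)

  transpose : ∀ {p q} {M : Fin p → Fin q → Bool} {ρ κ} → Represents M ρ κ → Represents (flip M) κ ρ
  transpose r = record { adj = Adj-sym ∘ adj ; non = Non-sym ∘ non ; rows = cols ; cols = rows }
    where
    open Represents r

  -- An induced path whose ends, row i and column j, can be prolonged using lexicality: the earliest
  -- column distinguishing rows i′ and i is nonadjacent to everything but row i, and dually.
  record Growing {p q} (M : Fin p → Fin q → Bool) (ρ : Fin p → V) (κ : Fin q → V)
    (i i′ : Fin p) (j j′ : Fin q) (mid : List V) : Set where
    field
      i<i′     : toℕ i < toℕ i′
      j<j′     : toℕ j < toℕ j′
      i′j      : M i′ j ≡ true
      ij′      : M i j′ ≡ true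
      ij       : M i j ≡ false
      path     : Path (ρ i) (mid ++ [ κ j ])
      free-col : ∀ c → toℕ c < toℕ j → M i′ c ≡ false → All (λ x → Non x (κ c)) mid
      free-row : ∀ r → toℕ r < toℕ i → M r j′ ≡ false → All (λ x → Non x (ρ r)) mid

  -- The two prolonging vertices either are adjacent and close an induced cycle, or are the ends of
  -- a longer path of the same kind, with rows and columns interchanged. Both indices decrease; as
  -- they change places in each round, `d` bounds both.
  grow : ∀ d {p q} {M : Fin p → Fin q → Bool} {ρ κ} → Represents M ρ κ → DoublyLexical M →
    ∀ {i i′ j j′ x mid} → toℕ i < d → toℕ j < d → Growing M ρ κ i i′ j j′ (x ∷ mid) → Cycle
  grow (suc d) {M = M} {ρ} {κ} rep (lexʳ , lexᶜ) {i} {i′} {j} {j′} {x} {mid} i<d j<d G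
    with j* , j*<j , i′j* , ij* , same-rows ← lexʳ (Growing.i<i′ G) (Growing.i′j G) (Growing.ij G)
       | i* , i*<i , i*j′ , i*j , same-cols ← lexᶜ (Growing.j<j′ G) (Growing.ij′ G) (Growing.ij G)
    with M i* j* in i*j*
  ... | true = cycle (s≤s (s≤s z≤n)) (adj i*j*)
                 (Non-sym (rows ij′ i*j′) ∷ All.map Non-sym (free-row i* i*<i i*j′))
                 (adj i*j)
                 (step (Adj-sym (adj ij*))
                   (Allₚ.++⁺ (All.map Non-sym (free-col j* j*<j i′j*)) (Non-sym (cols i′j i′j*) ∷ []))
                   path)
    where
    open Growing G
    open Represents rep
  ... | false = grow d (transpose rep) (lexᶜ , lexʳ)
                  (<-≤-trans j*<j (≤-pred j<d)) (<-≤-trans i*<i (≤-pred i<d))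
                  (record
                    { i<i′ = j*<j ; j<j′ = i*<i ; i′j = i*j ; ij′ = ij* ; ij = i*j*
                    ; path = path-snoc (ρ i ∷ x ∷ mid)
                        (step (Adj-sym (adj ij*))
                          (Allₚ.++⁺ (All.map Non-sym (free-col j* j*<j i′j*)) (Non-sym (cols i′j i′j*) ∷ []))
                          path)
                        (Non-sym (non i*j*))
                        (rows ij′ i*j′ ∷ free-row i* i*<i i*j′)
                        (Adj-sym (adj i*j))
                    -- Before `i*` the columns `j` and `j′` agree, so a row with a 0 in column `j`
                    -- has one in column `j′`, and the old `free-row` applies to it. Likewise for
                    -- columns before `j*`.
                    ; free-col = λ r r<i* rj → let rj′ = trans (same-cols r r<i*) rj in
                        rows ij′ rj′ ∷ Allₚ.++⁺ (free-row r (<-trans r<i* i*<i) rj′) (Non-sym (non rj) ∷ [])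
                    ; free-row = λ c c<j* ic → let i′c = trans (same-rows c c<j*) ic in
                        non ic ∷ Allₚ.++⁺ (free-col c (<-trans c<j* j*<j) i′c) (cols i′j i′c ∷ [])
                    })
    where
    open Growing G
    open Represents rep

  -- The three ones form the path `ρ i`, `κ j′`, `ρ i′`, `κ j`, and the zero makes it induced. It
  -- cannot grow for ever, since the indices of its ends decrease. This is why doubly lexical orders
  -- of totally balanced matrices avoid Γ.
  Γ⇒cycle : ∀ {p q} {M : Fin p → Fin q → Bool} {ρ κ} → Represents M ρ κ → DoublyLexical M →
    ∀ {i i′ j j′} → toℕ i < toℕ i′ → toℕ j < toℕ j′ →
    M i′ j′ ≡ true → M i′ j ≡ true → M i j′ ≡ true → M i j ≡ false → Cycle
  Γ⇒cycle rep lex {i} {i′} {j} {j′} i<i′ j<j′ i′j′ i′j ij′ ij =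
    grow (suc (toℕ i + toℕ j)) rep lex (s≤s (m≤m+n _ _)) (s≤s (m≤n+m _ (toℕ i))) (record
      { i<i′ = i<i′ ; j<j′ = j<j′ ; i′j = i′j ; ij′ = ij′ ; ij = ij
      ; path = step (adj ij′) (Non-sym (rows i′j ij) ∷ non ij ∷ [])
                 (step (Adj-sym (adj i′j′)) (cols ij′ ij ∷ []) (step (adj i′j) [] stop))
      ; free-col = λ c _ i′c → cols i′j′ i′c ∷ non i′c ∷ []
      ; free-row = λ r _ rj′ → Non-sym (non rj′) ∷ rows i′j′ rj′ ∷ []
      })
    where
    open Represents rep

  last : ∀ {n} {P : Fin n → Set} → (∀ i → Dec (P i)) → ∃ P → ∃ λ i → P i × (∀ j → P j → toℕ j ≤ toℕ i)
  last {suc n} {P} P? (i , Pi) with Finₚ.any? (P? ∘ suc)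
  ... | yes later with k , Pk , above ← last (P? ∘ suc) later =
    suc k , Pk , λ { zero _ → z≤n ; (suc j) Pj → s≤s (above j Pj) }
  ... | no ¬later with i
  ...   | zero = zero , Pi , λ { zero _ → z≤n ; (suc j) Pj → ⊥-elim (¬later (j , Pj)) }
  ...   | suc j = ⊥-elim (¬later (j , Pi))

  -- Golumbic–Goss, with the last nonzero row and its last nonzero column as the bisimplicial edge.
  cycle-or-bisimplicial : ∀ {p q} {M : Fin p → Fin q → Bool} {ρ κ} → Represents M ρ κ → DoublyLexical M →
    ∃ (λ i → ∃ λ j → M i j ≡ true) →
    Cycle ⊎ ∃ λ i → ∃ λ j → M i j ≡ true × (∀ i′ j′ → M i′ j ≡ true → M i j′ ≡ true → M i′ j′ ≡ true)
  cycle-or-bisimplicial {M = M} rep lex edge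
    with last (λ i → Finₚ.any? λ j → M i j Boolₚ.≟ true) edge
  ... | i , row , after-i with last (λ j → M i j Boolₚ.≟ true) row
  ... | j , ij , after-j
    with Finₚ.any? (λ i′ → Finₚ.any? λ j′ →
      (M i′ j Boolₚ.≟ true) ×-dec (M i j′ Boolₚ.≟ true) ×-dec (M i′ j′ Boolₚ.≟ false))
  ... | no ¬Γ = inj₂ (i , j , ij , λ i′ j′ i′j ij′ →
    Boolₚ.¬-not λ i′j′ → ¬Γ (i′ , j′ , i′j , ij′ , i′j′))
  ... | yes (i′ , j′ , i′j , ij′ , i′j′) = inj₁ (Γ⇒cycle rep lex
    (≤∧≢⇒< (after-i i′ (j , i′j)) λ e → absurd (trans (sym ij′) (trans (cong (λ k → M k j′) (sym (Finₚ.toℕ-injective e))) i′j′)))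
    (≤∧≢⇒< (after-j j′ ij′) λ e → absurd (trans (sym i′j) (trans (cong (M i′) (sym (Finₚ.toℕ-injective e))) i′j′)))
    ij ij′ i′j i′j′)
    where
    absurd : true ≢ false
    absurd ()

-- Prolonging induced paths in claw-free graphs.

module ClawFree {V : Set} (Adj Non : V → V → Set)
  (Adj-sym : ∀ {u v} → Adj u v → Adj v u) (Non-sym : ∀ {u v} → Non u v → Non v u)
  (Adj⇒¬Non : ∀ {u v} → Adj u v → ¬ Non u v)
  (adj-or-non : ∀ {u v} → u ≢ v → Adj u v ⊎ Non u v)
  (claw-free : ∀ {c u v w} → Adj c u → Adj c v → Adj c w → Non u v → Non u w → ¬ Non v w) where

  open InducedPaths Adj Non

  separated : ∀ {x y z} → Adj x y → Non x z → y ≢ z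
  separated a n refl = Adj⇒¬Non a n

  first-neighbour : ∀ w zs → All (w ≢_) zs →
    All (Non w) zs ⊎ ∃ λ ys → ∃ λ z → ∃ λ zs′ → zs ≡ ys ++ z ∷ zs′ × All (Non w) ys × Adj w z
  first-neighbour w [] [] = inj₁ []
  first-neighbour w (z ∷ zs) (≢ ∷ ≢s) with adj-or-non ≢
  ... | inj₁ a = inj₂ ([] , z , zs , refl , [] , a)
  ... | inj₂ n with first-neighbour w zs ≢s
  ...   | inj₁ ns = inj₁ (n ∷ ns)
  ...   | inj₂ (ys , z′ , zs′ , refl , ns , a) = inj₂ (z ∷ ys , z′ , zs′ , refl , n ∷ ns , a)

  -- If `w` has a neighbour beyond `y₂`, the first such neighbour closes an induced cycle, which the
  -- nonneighbours `y₁` and `y₂` make long enough.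
  prolong : ∀ {w x y₁ y₂ zs} → Path x (y₁ ∷ y₂ ∷ zs) → Adj w x → Non w y₁ → Non w y₂ →
    Cycle ⊎ Path w (x ∷ y₁ ∷ y₂ ∷ zs)
  prolong {w} {x} {y₁} {y₂} {zs} p@(step _ (_ ∷ ns) _) a n₁ n₂
    with first-neighbour w zs (All.map (separated (Adj-sym a)) ns)
  ... | inj₁ ms = inj₂ (step a (n₁ ∷ n₂ ∷ ms) p)
  ... | inj₂ (ys , z , zs′ , refl , ms , a′) =
    inj₁ (cycle (s≤s (s≤s z≤n)) a (n₁ ∷ n₂ ∷ ms) a′ (path-take (y₁ ∷ y₂ ∷ ys) p))

  -- If w₂ closes a 4-cycle with the first three vertices e₁ e₂ e₃, the path is rerouted as
  -- e₂ e₁ w₂ e₄ … and w₁ is put in front.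
  lengthen : ∀ {e₁ e₂ es w₁ w₂} → Path e₁ (e₂ ∷ es) →
    Adj w₂ e₁ → Non w₂ e₂ → Adj w₁ e₂ → Non w₁ e₁ → Non w₁ w₂ →
    Cycle ⊎ ∃ λ f₁ → ∃ λ f₂ → ∃ λ fs → Path f₁ (f₂ ∷ fs) × length fs ≡ suc (length es)
  lengthen {e₁} {e₂} {[]} {w₁} {w₂} p w₂e₁ w₂e₂ _ _ _ =
    inj₂ (w₂ , e₁ , e₂ ∷ [] , step w₂e₁ (w₂e₂ ∷ []) p , refl)
  lengthen {e₁} {e₂} {e₃ ∷ es} {w₁} {w₂} p@(step e₁e₂ (e₁e₃ ∷ e₁es) (step e₂e₃ e₂es q)) w₂e₁ w₂e₂ w₁e₂ w₁e₁ w₁w₂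
    with adj-or-non (separated (Adj-sym w₂e₁) e₁e₃)
  ... | inj₂ w₂e₃ = Sum.map₂ (λ r → _ , _ , _ , r , refl) (prolong p w₂e₁ w₂e₂ w₂e₃)
  ... | inj₁ w₂e₃ = Sum.map₂ (λ r → _ , _ , _ , r , refl)
    (prolong (step (Adj-sym e₁e₂) (Non-sym w₂e₂ ∷ e₂es) (step (Adj-sym w₂e₁) e₁es (rerouted q e₁es e₂es)))
      w₁e₂ w₁e₁ w₁w₂)
    where
    -- Why `w₂` can replace `e₃`: if `w₂` missed `e₄`, then `e₃` with `e₂`, `w₂`, `e₄` would be a
    -- claw; if it met a later vertex `z`, then `w₂` with `e₁`, `e₃`, `z` would be one.
    rerouted : ∀ {es} → Path e₃ es → All (Non e₁) es → All (Non e₂) es → Path w₂ es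
    rerouted stop _ _ = stop
    rerouted (step {y = e₄} e₃e₄ e₃es r) (e₁e₄ ∷ e₁es) (e₂e₄ ∷ _) with adj-or-non (separated (Adj-sym w₂e₁) e₁e₄)
    ... | inj₂ w₂e₄ = ⊥-elim (claw-free (Adj-sym e₂e₃) (Adj-sym w₂e₃) e₃e₄ (Non-sym w₂e₂) e₂e₄ w₂e₄)
    ... | inj₁ w₂e₄ = step w₂e₄ (All.zipWith far (e₁es , e₃es)) r
      where
      far : ∀ {z} → Non e₁ z × Non e₃ z → Non w₂ z
      far (e₁z , e₃z) with adj-or-non (separated (Adj-sym w₂e₁) e₁z)
      ... | inj₂ w₂z = w₂z
      ... | inj₁ w₂z = ⊥-elim (claw-free w₂e₁ w₂e₃ w₂z e₁e₃ e₁z e₃z)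

-- Trigraphs, their complements, and short odd paths.

_≟Θ_ : (s t : Θ) → Dec (s ≡ t)
plus  ≟Θ plus  = yes refl
plus  ≟Θ zer   = no λ ()
plus  ≟Θ minus = no λ ()
zer   ≟Θ plus  = no λ ()
zer   ≟Θ zer   = yes refl
zer   ≟Θ minus = no λ ()
minus ≟Θ plus  = no λ ()
minus ≟Θ zer   = no λ ()
minus ≟Θ minus = yes refl

neg-involutive : ∀ t → neg (neg t) ≡ t
neg-involutive plus  = refl
neg-involutive zer   = refl
neg-involutive minus = refl

neg-swap : ∀ {s t} → neg s ≡ t → s ≡ neg t
neg-swap {s} e = trans (sym (neg-involutive s)) (cong neg e)

parity : ∀ k → Even k ⊎ Odd k
parity zero = inj₁ (0 , refl)
parity (suc k) with parity k
... | inj₁ (m , refl) = inj₂ (m , refl)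
... | inj₂ (m , refl) = inj₁ (suc m , cong suc (sym (+-suc m m)))

does⁻ : ∀ {A : Set} (a? : Dec A) → does a? ≡ true → A
does⁻ (yes a) _ = a

bool-third : ∀ {a b c : Bool} → a ≢ b → c ≢ b → a ≡ c
bool-third a≢b c≢b = trans (Boolₚ.¬-not a≢b) (sym (Boolₚ.¬-not c≢b))

module _ (T : Trigraph) where

  private
    H = complement T

  P₄ : V T → V T → V T → V T → Set
  P₄ u a b v = Adjacent T u a × Adjacent T a b × Adjacent T b v × Antiadjacent T u b × Antiadjacent T a v

  P₆-free : Set
  P₆-free = ∀ p → ¬ IsPath T 5 p

  adjacent? : ∀ u v → Dec (Adjacent T u v)
  adjacent? u v = ¬? (u Finₚ.≟ v) ×-dec ((θ T u v ≟Θ plus) ⊎-dec (θ T u v ≟Θ zer))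

  antiadjacent? : ∀ u v → Dec (Antiadjacent T u v)
  antiadjacent? u v = ¬? (u Finₚ.≟ v) ×-dec ((θ T u v ≟Θ minus) ⊎-dec (θ T u v ≟Θ zer))

  find-P₄ : ∀ u v → Dec (∃ λ a → ∃ λ b → P₄ u a b v)
  find-P₄ u v = Finₚ.any? λ a → Finₚ.any? λ b →
    adjacent? u a ×-dec adjacent? a b ×-dec adjacent? b v ×-dec antiadjacent? u b ×-dec antiadjacent? a v

  anti-or-adjacent : ∀ {u v} → u ≢ v → StronglyAnti T u v ⊎ Adjacent T u v
  anti-or-adjacent {u} {v} u≢v with θ T u v
  ... | plus  = inj₂ (u≢v , inj₁ refl)
  ... | zer   = inj₂ (u≢v , inj₂ refl)
  ... | minus = inj₁ refl

  nonadjacent⇒anti : ∀ {u v} → u ≢ v → ¬ Adjacent T u v → StronglyAnti T u v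
  nonadjacent⇒anti u≢v ¬a with anti-or-adjacent u≢v
  ... | inj₁ m = m
  ... | inj₂ a = ⊥-elim (¬a a)

  clash : ∀ {u v} → Adjacent T u v → ¬ StronglyAnti T u v
  clash (_ , inj₁ p) m with () ← trans (sym p) m
  clash (_ , inj₂ z) m with () ← trans (sym z) m

  clash′ : ∀ {u v} → Antiadjacent T u v → ¬ StronglyAdj T u v
  clash′ (_ , inj₁ p) m with () ← trans (sym p) m
  clash′ (_ , inj₂ z) m with () ← trans (sym z) m

  anti-sym : ∀ {u v} → StronglyAnti T u v → StronglyAnti T v u
  anti-sym {u} {v} = trans (Trigraph.sym T v u)

  semi-sym : ∀ {u v} → Semi T u v → Semi T v u
  semi-sym {u} {v} (u≢v , z) = ≢-sym u≢v , trans (Trigraph.sym T v u) z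

  both⇒semi : ∀ {u v} → Adjacent T u v → Antiadjacent T u v → Semi T u v
  both⇒semi (u≢v , inj₂ z) _ = u≢v , z
  both⇒semi (_ , inj₁ p) n = ⊥-elim (clash′ n p)

  adjacent⇒co-antiadjacent : ∀ {u v} → Adjacent T u v → Antiadjacent H u v
  adjacent⇒co-antiadjacent (u≢v , a) = u≢v , Sum.map (cong neg) (cong neg) a

  antiadjacent⇒co-adjacent : ∀ {u v} → Antiadjacent T u v → Adjacent H u v
  antiadjacent⇒co-adjacent (u≢v , a) = u≢v , Sum.map (cong neg) (cong neg) a

  co-antiadjacent⇒adjacent : ∀ {u v} → Antiadjacent H u v → Adjacent T u v
  co-antiadjacent⇒adjacent (u≢v , a) = u≢v , Sum.map neg-swap neg-swap a

  co-adjacent⇒antiadjacent : ∀ {u v} → Adjacent H u v → Antiadjacent T u v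
  co-adjacent⇒antiadjacent (u≢v , a) = u≢v , Sum.map neg-swap neg-swap a

  complete-or-anti : Complete T ⊎ ∃ λ u → ∃ λ v → u ≢ v × StronglyAnti T u v
  complete-or-anti with Finₚ.any? (λ u → Finₚ.any? λ v → ¬? (u Finₚ.≟ v) ×-dec (θ T u v ≟Θ minus))
  ... | yes anti = inj₂ anti
  ... | no ¬anti = inj₁ complete
    where
    complete : Complete T
    complete u v u≢v with anti-or-adjacent u≢v
    ... | inj₁ m = ⊥-elim (¬anti (u , v , u≢v , m))
    ... | inj₂ a = a

  complete-or-third : ∀ {x y} → Semi T x y → Complete T ⊎ ∃ λ w → w ≢ x × w ≢ y
  complete-or-third {x} {y} (x≢y , z)
    with Finₚ.any? (λ w → ¬? (w Finₚ.≟ x) ×-dec ¬? (w Finₚ.≟ y))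
  ... | yes third = inj₂ third
  ... | no ¬third = inj₁ complete
    where
    complete : Complete T
    complete u v u≢v with u Finₚ.≟ x | u Finₚ.≟ y | v Finₚ.≟ x | v Finₚ.≟ y
    ... | no u≢x   | no u≢y   | _        | _        = ⊥-elim (¬third (u , u≢x , u≢y))
    ... | _        | _        | no v≢x   | no v≢y   = ⊥-elim (¬third (v , v≢x , v≢y))
    ... | yes refl | _        | yes refl | _        = ⊥-elim (u≢v refl)
    ... | yes refl | _        | no _     | yes refl = u≢v , inj₂ z
    ... | no _     | yes refl | yes refl | _        = adjacent-sym T (x≢y , inj₂ z)
    ... | no _     | yes refl | no _     | yes refl = ⊥-elim (u≢v refl)

  path-prefix : ∀ {j k p} (j≤k : j ≤ k) → IsPath T k p → IsPath T j (p ∘ λ i → inject≤ i (s≤s j≤k))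
  path-prefix j≤k (injective , consecutive , distant) =
    (λ e → Finₚ.inject≤-injective _ _ _ _ (injective e)) ,
    (λ i j e → consecutive _ _ (trans (cong suc (toℕ≡ i)) (trans e (sym (toℕ≡ j))))) ,
    (λ i j l → distant _ _ (subst₂ (λ a b → suc (suc a) ≤ b) (sym (toℕ≡ i)) (sym (toℕ≡ j)) l))
    where
    toℕ≡ : ∀ i → toℕ (inject≤ i (s≤s j≤k)) ≡ toℕ i
    toℕ≡ i = Finₚ.toℕ-inject≤ i (s≤s j≤k)

  evenPair : ∀ {u v} → P₆-free → u ≢ v → StronglyAnti T u v → (∀ a b → ¬ P₄ u a b v) → IsEvenPair T u v
  evenPair {u} {v} P₆-free u≢v uv ¬P₄ = u≢v , uv , even
    where
    even : ∀ k p → IsPath T k p → p zero ≡ u → p (fromℕ k) ≡ v → Even k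
    even k p path u≡ v≡ with parity k
    ... | inj₁ e = e
    even _ p (_ , consecutive , _) refl refl | inj₂ (0 , refl) =
      ⊥-elim (clash (consecutive zero (suc zero) refl) uv)
    even _ p (_ , consecutive , distant) refl refl | inj₂ (1 , refl) =
      ⊥-elim (¬P₄ (p (suc zero)) (p (suc (suc zero)))
        ( consecutive _ _ refl , consecutive _ _ refl , consecutive _ _ refl
        , distant _ _ (s≤s (s≤s z≤n)) , distant _ _ (s≤s (s≤s (s≤s z≤n)))))
    even _ p path refl refl | inj₂ (suc (suc m) , refl) = ⊥-elim (P₆-free _ (path-prefix five path))
      where
      five : 5 ≤ suc (suc (suc m) + suc (suc m))
      five rewrite +-suc m (suc m) | +-suc m m = s≤s (s≤s (s≤s (s≤s (s≤s z≤n))))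

  -- `v₀`, `v₂`, `v₄` form a triangle of H, which is absurd when H is bipartite. When H is a line
  -- trigraph, `v₅` is needed as well: it meets `v₀` and `v₂` in H and yet is adjacent in T to `v₄`.
  P₆-pairs : ∀ {p} → IsPath T 5 p →
    let v₀ = p zero ; v₂ = p (suc (suc zero)) ; v₄ = p (suc (suc (suc (suc zero))))
        v₅ = p (suc (suc (suc (suc (suc zero))))) in
    Antiadjacent T v₀ v₂ × Antiadjacent T v₀ v₄ × Antiadjacent T v₂ v₄
    × Antiadjacent T v₀ v₅ × Antiadjacent T v₂ v₅ × Adjacent T v₄ v₅
  P₆-pairs (_ , consecutive , distant) =
    distant _ _ (s≤s (s≤s z≤n)) , distant _ _ (s≤s (s≤s z≤n)) , distant _ _ (s≤s (s≤s (s≤s (s≤s z≤n)))) ,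
    distant _ _ (s≤s (s≤s z≤n)) , distant _ _ (s≤s (s≤s (s≤s (s≤s z≤n)))) , consecutive _ _ refl

  -- Complements of bipartite trigraphs.

  module CoBipartite (f : V T → Bool) (bip : ∀ u v → u ≢ v → f u ≡ f v → StronglyAnti H u v) where

    same : ∀ {u v} → u ≢ v → f u ≡ f v → StronglyAdj T u v
    same u≢v e = neg-swap (bip _ _ u≢v e)

    same-adjacent : ∀ {u v} → u ≢ v → f u ≡ f v → Adjacent T u v
    same-adjacent u≢v e = u≢v , inj₁ (same u≢v e)

    cross : ∀ {u v} → Antiadjacent T u v → f u ≢ f v
    cross n e = clash′ n (same (proj₁ n) e)

    no-P₆ : P₆-free
    no-P₆ p path with n₀₂ , n₀₄ , n₂₄ , _ ← P₆-pairs path =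
      cross n₀₄ (bool-third (cross n₀₂) (cross n₂₄ ∘ sym))

    no-light : ∀ {v x y} → Semi T v x → Semi T v y → x ≢ y → ¬ StronglyAnti T x y
    no-light (v≢x , vx) (v≢y , vy) x≢y xy =
      cross (x≢y , inj₁ xy) (bool-third (cross (v≢x , inj₂ vx) ∘ sym) (cross (v≢y , inj₂ vy) ∘ sym))

    strongly-anti : V T → V T → Bool
    strongly-anti u v = does (θ T u v ≟Θ minus)

    strongly-anti⁺ : ∀ {u v} → StronglyAnti T u v → strongly-anti u v ≡ true
    strongly-anti⁺ {u} {v} = dec-true (θ T u v ≟Θ minus)

    strongly-anti⁻ : ∀ {u v} → strongly-anti u v ≡ true → StronglyAnti T u v
    strongly-anti⁻ {u} {v} = does⁻ (θ T u v ≟Θ minus)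

    open ChordalBipartite (Adjacent H) (Antiadjacent H) (adjacent-sym H) (antiadjacent-sym H)

    represents : ∀ {xs ys} → All (λ v → f v ≡ true) xs → All (λ v → f v ≡ false) ys →
      Represents (submatrix strongly-anti xs ys) (lookup xs) (lookup ys)
    represents {xs} {ys} fxs fys = record
      { adj  = λ {i} {j} e → antiadjacent⇒co-adjacent (differ i j , inj₁ (strongly-anti⁻ e))
      ; non  = λ {i} {j} e → adjacent⇒co-antiadjacent (adjacent i j e)
      ; rows = λ {i} {i′} {j} e e′ → adjacent⇒co-antiadjacent (same-adjacent
          (λ ≡ → absurd (trans (sym e) (trans (cong (λ u → strongly-anti u (lookup ys j)) ≡) e′)))
          (trans (row i) (sym (row i′))))
      ; cols = λ {i} {j} {j′} e e′ → adjacent⇒co-antiadjacent (same-adjacent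
          (λ ≡ → absurd (trans (sym e) (trans (cong (strongly-anti (lookup xs i)) ≡) e′)))
          (trans (col j) (sym (col j′))))
      }
      where
      absurd : true ≢ false
      absurd ()
      row : ∀ i → f (lookup xs i) ≡ true
      row i = All.lookup fxs (∈-lookup i)
      col : ∀ j → f (lookup ys j) ≡ false
      col j = All.lookup fys (∈-lookup j)
      differ : ∀ i j → lookup xs i ≢ lookup ys j
      differ i j ≡ = absurd (trans (sym (row i)) (trans (cong f ≡) (col j)))
      adjacent : ∀ i j → strongly-anti (lookup xs i) (lookup ys j) ≡ false → Adjacent T (lookup xs i) (lookup ys j)
      adjacent i j e with anti-or-adjacent (differ i j)
      ... | inj₁ m = ⊥-elim (absurd (trans (sym (strongly-anti⁺ m)) e))
      ... | inj₂ a = a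

    coloured-edge-evenPair : ¬ HasAntihole T → (∀ u w → ¬ Semi T u w) →
      ∀ {u v} → f u ≡ true → f v ≡ false → StronglyAnti T u v → HasEvenPair T
    coloured-edge-evenPair ¬antihole ¬semi {u} {v} fu fv uv
      with xs , ys , p , q , lex ← doublyLexical-reordering strongly-anti
        (filter (λ v → f v Boolₚ.≟ true) (allFin (n T))) (filter (λ v → f v Boolₚ.≟ false) (allFin (n T)))
      = conclude (cycle-or-bisimplicial (represents fxs fys) lex
          (index (∈xs fu) , index (∈ys fv) , strongly-anti⁺ (at (∈xs fu) (∈ys fv) uv)))
      where
      fxs : All (λ v → f v ≡ true) xs
      fxs = All-resp-↭ (↭-sym p) (Allₚ.all-filter (λ v → f v Boolₚ.≟ true) (allFin (n T)))
      fys : All (λ v → f v ≡ false) ys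
      fys = All-resp-↭ (↭-sym q) (Allₚ.all-filter (λ v → f v Boolₚ.≟ false) (allFin (n T)))
      ∈xs : ∀ {v} → f v ≡ true → v ∈ˡ xs
      ∈xs {v} fv = ∈-resp-↭ (↭-sym p) (∈-filter⁺ (λ v → f v Boolₚ.≟ true) (∈-allFin v) fv)
      ∈ys : ∀ {v} → f v ≡ false → v ∈ˡ ys
      ∈ys {v} fv = ∈-resp-↭ (↭-sym q) (∈-filter⁺ (λ v → f v Boolₚ.≟ false) (∈-allFin v) fv)
      at : ∀ {u v} (u∈ : u ∈ˡ xs) (v∈ : v ∈ˡ ys) → StronglyAnti T u v →
        StronglyAnti T (lookup xs (index u∈)) (lookup ys (index v∈))
      at u∈ v∈ = subst₂ (StronglyAnti T) (lookup-index u∈) (lookup-index v∈)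
      back : ∀ {u v} (u∈ : u ∈ˡ xs) (v∈ : v ∈ˡ ys) →
        StronglyAnti T (lookup xs (index u∈)) (lookup ys (index v∈)) → StronglyAnti T u v
      back u∈ v∈ = subst₂ (StronglyAnti T) (sym (lookup-index u∈)) (sym (lookup-index v∈))
      strong : ∀ {u v} → Antiadjacent T u v → StronglyAnti T u v
      strong n = nonadjacent⇒anti (proj₁ n) λ a → ¬semi _ _ (both⇒semi a n)

      conclude : InducedPaths.Cycle (Adjacent H) (Antiadjacent H)
        ⊎ (∃ λ i → ∃ λ j → submatrix strongly-anti xs ys i j ≡ true
            × (∀ i′ j′ → submatrix strongly-anti xs ys i′ j ≡ true → submatrix strongly-anti xs ys i j′ ≡ true →
                submatrix strongly-anti xs ys i′ j′ ≡ true)) → HasEvenPair T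
      conclude (inj₁ c) = ⊥-elim (¬antihole (cycle⇒hole H c))
      conclude (inj₂ (i , j , ij , complete)) = a , b , evenPair no-P₆ a≢b ab ¬P₄
        where
        a b : V T
        a = lookup xs i
        b = lookup ys j
        fa : f a ≡ true
        fa = All.lookup fxs (∈-lookup i)
        fb : f b ≡ false
        fb = All.lookup fys (∈-lookup j)
        ab : StronglyAnti T a b
        ab = strongly-anti⁻ ij
        a≢b : a ≢ b
        a≢b e with () ← trans (sym fa) (trans (cong f e) fb)
        -- In H, `a′` is a neighbour of `b` and `b′` one of `a`, so bisimpliciality makes `a′`, `b′`
        -- strongly antiadjacent in T, against the middle edge of the P₄.
        ¬P₄ : ∀ a′ b′ → ¬ P₄ a a′ b′ b
        ¬P₄ a′ b′ (aa′ , a′b′ , b′b , ab′ , a′b) = clash a′b′ (back a′∈ b′∈ (strongly-anti⁻ (complete _ _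
          (strongly-anti⁺ (subst (λ u → StronglyAnti T u b) (lookup-index a′∈) (strong a′b)))
          (strongly-anti⁺ (subst (StronglyAnti T a) (lookup-index b′∈) (strong ab′))))))
          where
          a′∈ : a′ ∈ˡ xs
          a′∈ = ∈xs (Boolₚ.¬-not λ e → cross a′b (trans e (sym fb)))
          b′∈ : b′ ∈ˡ ys
          b′∈ = ∈ys (Boolₚ.¬-not λ e → cross ab′ (trans fa (sym e)))

    edge-evenPair : ¬ HasAntihole T → (∀ u w → ¬ Semi T u w) →
      ∀ {u v} → u ≢ v → StronglyAnti T u v → HasEvenPair T
    edge-evenPair ¬antihole ¬semi {u} {v} u≢v uv with f u in fu | f v in fv
    ... | true  | false = coloured-edge-evenPair ¬antihole ¬semi fu fv uv
    ... | false | true  = coloured-edge-evenPair ¬antihole ¬semi fv fu (anti-sym uv)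
    ... | true  | true  = ⊥-elim (cross (u≢v , inj₁ uv) (trans fu (sym fv)))
    ... | false | false = ⊥-elim (cross (u≢v , inj₁ uv) (trans fu (sym fv)))

    module Small {x y} (xy : Semi T x y)
      (only : ∀ u w → Semi T u w → (u ≡ x × w ≡ y) ⊎ (u ≡ y × w ≡ x))
      (no-common : ∀ w → ¬ (Adjacent T x w × Adjacent T y w)) where

      x≁y : f x ≢ f y
      x≁y = cross (proj₁ xy , inj₂ (proj₂ xy))

      -- The side of `x` is a strong clique, so a vertex `a` on it that is adjacent to `y` would be
      -- a common neighbour of `x` and `y`.
      anti-y : ∀ {a} → a ≢ x → f a ≡ f x → StronglyAnti T y a
      anti-y {a} a≢x fa = nonadjacent⇒anti (λ { refl → x≁y (sym fa) })
        λ ya → no-common a (same-adjacent (≢-sym a≢x) (sym fa) , ya)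

      anti-x : ∀ {b} → b ≢ y → f b ≡ f y → StronglyAnti T x b
      anti-x {b} b≢y fb = nonadjacent⇒anti (λ { refl → x≁y fb })
        λ xb → no-common b (xb , same-adjacent (≢-sym b≢y) (sym fb))

      opposite? : ∀ b a → Dec (f a ≡ f x × StronglyAnti T a b)
      opposite? b a = (f a Boolₚ.≟ f x) ×-dec (θ T a b ≟Θ minus)

      opposite : V T → Subset (n T)
      opposite b = tabulate λ a → does (opposite? b a)

      opposite⁺ : ∀ {a b} → f a ≡ f x → StronglyAnti T a b → a ∈ opposite b
      opposite⁺ {a} {b} fa ab =
        lookup⇒[]= a _ (trans (lookup∘tabulate _ a) (dec-true (opposite? b a) (fa , ab)))

      opposite⁻ : ∀ {a b} → a ∈ opposite b → f a ≡ f x × StronglyAnti T a b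
      opposite⁻ {a} {b} a∈ =
        does⁻ (opposite? b a) (trans (sym (lookup∘tabulate _ a)) ([]=⇒lookup a∈))

      -- A path x a′ b′ b makes the strong antineighbourhood of b′ a proper subset of that of b:
      -- a vertex a″ antiadjacent to b′ but not to b closes the antihole x b a′ y a″ b′.
      smaller : ¬ HasAntihole T → ∀ {a′ b′ b} → b ≢ y → f b ≡ f y → P₄ x a′ b′ b →
        b′ ≢ y × f b′ ≡ f y × ∣ opposite b′ ∣ < ∣ opposite b ∣
      smaller ¬antihole {a′} {b′} {b} b≢y fb (xa′ , a′b′ , b′b , xb′ , a′b) =
        b′≢y , fb′ , p⊂q⇒∣p∣<∣q∣ (⊆ , a′ , opposite⁺ fa′ a′-anti-b , clash a′b′ ∘ proj₂ ∘ opposite⁻)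
        where
        b′≢y : b′ ≢ y
        b′≢y refl = no-common a′ (xa′ , adjacent-sym T a′b′)
        fb′ : f b′ ≡ f y
        fb′ = bool-third (cross xb′ ∘ sym) (x≁y ∘ sym)
        fa′ : f a′ ≡ f x
        fa′ = bool-third (cross a′b) (λ e → x≁y (trans e fb))
        a′-anti-b : StronglyAnti T a′ b
        a′-anti-b with proj₂ a′b
        ... | inj₁ m = m
        ... | inj₂ z with only _ _ (proj₁ a′b , z)
        ...   | inj₁ (_ , b≡y) = ⊥-elim (b≢y b≡y)
        ...   | inj₂ (a′≡y , _) = ⊥-elim (x≁y (trans (sym fa′) (cong f a′≡y)))
        ⊆ : ∀ {a″} → a″ ∈ opposite b′ → a″ ∈ opposite b
        ⊆ {a″} a″∈ with fa″ , a″b′ ← opposite⁻ a″∈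
          with anti-or-adjacent {a″} {b} (λ { refl → x≁y (trans (sym fa″) fb) })
        ... | inj₁ m = opposite⁺ fa″ m
        ... | inj₂ a″b = ⊥-elim (¬antihole (cycle⇒hole H (cycle (s≤s (s≤s z≤n))
              (adj (x≢b , inj₁ (anti-x b≢y fb)))
              (non xa′ ∷ non (proj₁ xy , inj₂ (proj₂ xy)) ∷ non (same-adjacent (≢-sym a″≢x) (sym fa″)) ∷ [])
              (adj xb′)
              (step (adj (antiadjacent-sym T a′b))
                (non (same-adjacent b≢y fb) ∷ non (adjacent-sym T a″b) ∷ non (adjacent-sym T b′b) ∷ [])
              (step (adj (opposite-y fa′ , inj₁ (anti-sym (anti-y (≢-sym (proj₁ xa′)) fa′))))
                (non (same-adjacent a′≢a″ (trans fa′ (sym fa″))) ∷ non a′b′ ∷ [])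
              (step (adj (≢-sym (opposite-y fa″) , inj₁ (anti-y a″≢x fa″)))
                (non (same-adjacent (≢-sym b′≢y) (sym fb′)) ∷ [])
              (step (adj ((λ { refl → x≁y (trans (sym fa″) fb′) }) , inj₁ a″b′)) [] stop)))))))
          where
          open InducedPaths (Adjacent H) (Antiadjacent H)
          adj : ∀ {u v} → Antiadjacent T u v → Adjacent H u v
          adj = antiadjacent⇒co-adjacent
          non : ∀ {u v} → Adjacent T u v → Antiadjacent H u v
          non = adjacent⇒co-antiadjacent
          x≢b : x ≢ b
          x≢b refl = x≁y fb
          a″≢x : a″ ≢ x
          a″≢x refl = clash a″b (anti-x b≢y fb)
          a′≢a″ : a′ ≢ a″
          a′≢a″ refl = clash a′b′ a″b′
          opposite-y : ∀ {a} → f a ≡ f x → a ≢ y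
          opposite-y fa refl = x≁y (sym fa)

      -- Each P₄ from `x` to `b` supplies a new candidate on the side of `y` with a smaller
      -- `opposite`; where no P₄ is left, `x` and the candidate are an even pair.
      descend : ¬ HasAntihole T → ∀ d b → b ≢ y → f b ≡ f y → ∣ opposite b ∣ < d → HasEvenPair T
      descend ¬antihole (suc d) b b≢y fb <d with find-P₄ x b
      ... | no ¬P₄ = x , b , evenPair no-P₆ (λ { refl → x≁y fb }) (anti-x b≢y fb) λ a′ b′ p → ¬P₄ (a′ , b′ , p)
      ... | yes (a′ , b′ , p) with b′≢y , fb′ , lt ← smaller ¬antihole b≢y fb p =
        descend ¬antihole d b′ b′≢y fb′ (<-≤-trans lt (≤-pred <d))

      far-evenPair : ¬ HasAntihole T → ∀ {b} → b ≢ y → f b ≡ f y → HasEvenPair T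
      far-evenPair ¬antihole {b} b≢y fb = descend ¬antihole (suc ∣ opposite b ∣) b b≢y fb ≤-refl

    small-evenPair : ∀ {x y} → Semi T x y → (∀ u w → Semi T u w → (u ≡ x × w ≡ y) ⊎ (u ≡ y × w ≡ x)) →
      (∀ w → ¬ (Adjacent T x w × Adjacent T y w)) → ¬ HasAntihole T → Complete T ⊎ HasEvenPair T
    small-evenPair {x} {y} xy only no-common ¬antihole = Sum.map₂ even (complete-or-third xy)
      where
      even : (∃ λ w → w ≢ x × w ≢ y) → HasEvenPair T
      even (w , w≢x , w≢y) with f w Boolₚ.≟ f y
      ... | yes fw = Small.far-evenPair xy only no-common ¬antihole w≢y fw
      ... | no fw  = Small.far-evenPair (semi-sym xy) (λ u w → Sum.swap ∘ only u w) (λ w → no-common w ∘ swap)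
                       ¬antihole w≢x (bool-third fw (cross (proj₁ xy , inj₂ (proj₂ xy))))

    -- What N(x) or N(y) misses lies on one side, hence is a clique.
    small-unfavorable : ∀ {x y} → ¬ Favorable T (small x y)
    small-unfavorable (_ , _ , inj₁ (u , w , ∉u , ∉w , ¬xu , ¬xw , u≢w , ¬uw)) = ¬uw (same-adjacent u≢w
      (bool-third (¬xu ∘ same-adjacent (≢-sym (∉u ∘ inj₁)) ∘ sym) (¬xw ∘ same-adjacent (≢-sym (∉w ∘ inj₁)) ∘ sym)))
    small-unfavorable (_ , _ , inj₂ (u , w , ∉u , ∉w , ¬yu , ¬yw , u≢w , ¬uw)) = ¬uw (same-adjacent u≢w
      (bool-third (¬yu ∘ same-adjacent (≢-sym (∉u ∘ inj₂)) ∘ sym) (¬yw ∘ same-adjacent (≢-sym (∉w ∘ inj₂)) ∘ sym)))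

  -- Complements of line trigraphs.

  -- Vertices of T are edges of a bipartite graph; end s u is the end of u on side s.
  module CoLine {l r} (e : V T → Fin l × Fin r) (e-injective : Injective _≡_ _≡_ e)
    (line : ∀ u v → u ≢ v →
      (Adjacent H u v → proj₁ (e u) ≡ proj₁ (e v) ⊎ proj₂ (e u) ≡ proj₂ (e v))
      × (proj₁ (e u) ≡ proj₁ (e v) ⊎ proj₂ (e u) ≡ proj₂ (e v) → Adjacent H u v))
    (strong : ∀ X → 3 ≤ ∣ X ∣ → IsClique H X → IsStrongClique H X) where

    -- Natural numbers give the two sides a common type, so that an argument made for a side `s`
    -- serves for both.
    end : Bool → V T → ℕ
    end true  u = toℕ (proj₁ (e u))
    end false u = toℕ (proj₂ (e u))

    end-injective : ∀ s {u v} → end s u ≡ end s v → end (not s) u ≡ end (not s) v → u ≡ v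
    end-injective true  p q = e-injective (cong₂ _,_ (Finₚ.toℕ-injective p) (Finₚ.toℕ-injective q))
    end-injective false p q = end-injective true q p

    meet⁺ : ∀ s {u v} → u ≢ v → end s u ≡ end s v → Antiadjacent T u v
    meet⁺ true  u≢v p = co-adjacent⇒antiadjacent (proj₂ (line _ _ u≢v) (inj₁ (Finₚ.toℕ-injective p)))
    meet⁺ false u≢v p = co-adjacent⇒antiadjacent (proj₂ (line _ _ u≢v) (inj₂ (Finₚ.toℕ-injective p)))

    meet⁻ : ∀ s {u v} → Antiadjacent T u v → end s u ≡ end s v ⊎ end (not s) u ≡ end (not s) v
    meet⁻ true n = Sum.map (cong toℕ) (cong toℕ) (proj₁ (line _ _ (proj₁ n)) (antiadjacent⇒co-adjacent n))
    meet⁻ false n = Sum.swap (meet⁻ true n)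

    -- Otherwise `w` meets both `u` and `v` on the other side, and these two would have both ends in
    -- common. A bipartite graph has no triangle, so triangles of its line graph come from stars.
    triangle-end : ∀ s {u v w} → u ≢ v → end s u ≡ end s v → Antiadjacent T w u → Antiadjacent T w v →
      end s w ≡ end s u
    triangle-end s u≢v p wu wv with meet⁻ s wu | meet⁻ s wv
    ... | inj₁ q | _ = q
    ... | inj₂ _ | inj₁ q = trans q (sym p)
    ... | inj₂ q | inj₂ q′ = ⊥-elim (u≢v (end-injective s p (trans (sym q) q′)))

    triangle : ∀ {u v w} → Antiadjacent T u v → Antiadjacent T u w → Antiadjacent T v w → StronglyAnti T u v
    triangle {u} {v} {w} uv uw vw = neg-swap (strong X 3≤∣X∣ clique u v u∈ v∈ (proj₁ uv))
      where
      X : Subset (n T)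
      X = ⁅ u ⁆ ∪ (⁅ v ⁆ ∪ ⁅ w ⁆)

      u∈ : u ∈ X
      u∈ = x∈p∪q⁺ (inj₁ (x∈⁅x⁆ u))

      v∈ : v ∈ X
      v∈ = x∈p∪q⁺ (inj₂ (x∈p∪q⁺ (inj₁ (x∈⁅x⁆ v))))

      members : ∀ {z} → z ∈ X → z ≡ u ⊎ z ≡ v ⊎ z ≡ w
      members z∈ = Sum.map (x∈⁅y⁆⇒x≡y _) (Sum.map (x∈⁅y⁆⇒x≡y _) (x∈⁅y⁆⇒x≡y _) ∘ x∈p∪q⁻ _ _) (x∈p∪q⁻ _ _ z∈)

      3≤∣X∣ : 3 ≤ ∣ X ∣
      -- Two proper inclusions, from `⁅ w ⁆` to `⁅ v ⁆ ∪ ⁅ w ⁆` to `X`, each raise the size.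
      3≤∣X∣ = ≤-trans (s≤s (subst (_< ∣ ⁅ v ⁆ ∪ ⁅ w ⁆ ∣) (∣⁅x⁆∣≡1 w)
          (p⊂q⇒∣p∣<∣q∣ (q⊆p∪q ⁅ v ⁆ ⁅ w ⁆ , v , x∈p∪q⁺ (inj₁ (x∈⁅x⁆ v)) , proj₁ vw ∘ x∈⁅y⁆⇒x≡y _))))
        (p⊂q⇒∣p∣<∣q∣ (q⊆p∪q ⁅ u ⁆ (⁅ v ⁆ ∪ ⁅ w ⁆) , u , u∈ ,
          Sum.[ proj₁ uv ∘ x∈⁅y⁆⇒x≡y _ , proj₁ uw ∘ x∈⁅y⁆⇒x≡y _ ] ∘ x∈p∪q⁻ _ _))

      clique : IsClique H X
      clique a b a∈ b∈ a≢b with members a∈ | members b∈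
      ... | inj₁ refl        | inj₁ refl        = ⊥-elim (a≢b refl)
      ... | inj₁ refl        | inj₂ (inj₁ refl) = antiadjacent⇒co-adjacent uv
      ... | inj₁ refl        | inj₂ (inj₂ refl) = antiadjacent⇒co-adjacent uw
      ... | inj₂ (inj₁ refl) | inj₁ refl        = antiadjacent⇒co-adjacent (antiadjacent-sym T uv)
      ... | inj₂ (inj₁ refl) | inj₂ (inj₁ refl) = ⊥-elim (a≢b refl)
      ... | inj₂ (inj₁ refl) | inj₂ (inj₂ refl) = antiadjacent⇒co-adjacent vw
      ... | inj₂ (inj₂ refl) | inj₁ refl        = antiadjacent⇒co-adjacent (antiadjacent-sym T uw)
      ... | inj₂ (inj₂ refl) | inj₂ (inj₁ refl) = antiadjacent⇒co-adjacent (antiadjacent-sym T vw)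
      ... | inj₂ (inj₂ refl) | inj₂ (inj₂ refl) = ⊥-elim (a≢b refl)

    -- For a switchable pair `u`, `v` this is the condition on cliques of size 3. It serves to
    -- refute adjacency after `meet⁺`, since a common end alone still permits a switchable pair.
    no-triangle : ∀ {u v w} → Adjacent T u v → Antiadjacent T u v → Antiadjacent T u w → ¬ Antiadjacent T v w
    no-triangle a uv uw vw = clash a (triangle uv uw vw)

    no-P₆ : P₆-free
    no-P₆ p path
      with n₀₂ , n₀₄ , n₂₄ , n₀₅ , n₂₅ , a₄₅ ← P₆-pairs path
      = Sum.[ apart true , apart false ] (meet⁻ true n₀₂)
      where
      apart : ∀ s → end s (p zero) ≡ end s (p (suc (suc zero))) → ⊥
      -- The common end of `v₀` and `v₂` is forced on `v₄` and `v₅` too, so the adjacent pair `v₄`,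
      -- `v₅` lies in a triangle of H with `v₀`.
      apart s q = no-triangle a₄₅
        (meet⁺ s (proj₁ a₄₅) (trans (through₀ n₀₄ n₂₄) (sym (through₀ n₀₅ n₂₅))))
        (antiadjacent-sym T n₀₄) (antiadjacent-sym T n₀₅)
        where
        through₀ : ∀ {w} → Antiadjacent T (p zero) w → Antiadjacent T (p (suc (suc zero))) w → end s w ≡ end s (p zero)
        through₀ n₀ n₂ = triangle-end s (proj₁ n₀₂) q (antiadjacent-sym T n₀) (antiadjacent-sym T n₂)

    no-light : ∀ {v x y} → Semi T v x → Semi T v y → x ≢ y → ¬ StronglyAnti T x y
    no-light (v≢x , vx) (v≢y , vy) x≢y xy =
      no-triangle (v≢x , inj₂ vx) (v≢x , inj₂ vx) (v≢y , inj₂ vy) (x≢y , inj₁ xy)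

    module NoSemi (¬semi : ∀ u w → ¬ Semi T u w) where

      never-both : ∀ {u v} → Adjacent T u v → ¬ Antiadjacent T u v
      never-both a n = ¬semi _ _ (both⇒semi a n)

      disjoint : ∀ s {c u v} → Antiadjacent H u v → end s c ≡ end s u → end s c ≢ end s v
      disjoint s uv p q = never-both (co-antiadjacent⇒adjacent uv) (meet⁺ s (proj₁ uv) (trans (sym p) q))

      -- `c` has two ends, so two of its three neighbours contain the same one and meet each other.
      claw-free : ∀ {c u v w} → Adjacent H c u → Adjacent H c v → Adjacent H c w →
        Antiadjacent H u v → Antiadjacent H u w → ¬ Antiadjacent H v w
      claw-free cu cv cw uv uw vw
        with meet⁻ true (co-adjacent⇒antiadjacent cu) | meet⁻ true (co-adjacent⇒antiadjacent cv)
           | meet⁻ true (co-adjacent⇒antiadjacent cw)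
      ... | inj₁ p | inj₁ q | _      = disjoint true uv p q
      ... | inj₂ p | inj₂ q | _      = disjoint false uv p q
      ... | inj₁ p | inj₂ _ | inj₁ q = disjoint true uw p q
      ... | inj₂ p | inj₁ _ | inj₂ q = disjoint false uw p q
      ... | inj₁ _ | inj₂ p | inj₂ q = disjoint false vw p q
      ... | inj₂ _ | inj₁ p | inj₁ q = disjoint true vw p q

      open InducedPaths (Adjacent H) (Antiadjacent H)
      open ClawFree (Adjacent H) (Antiadjacent H) (adjacent-sym H) (antiadjacent-sym H)
        (λ a n → never-both (co-antiadjacent⇒adjacent n) (co-adjacent⇒antiadjacent a))
        (λ u≢v → Sum.map (λ m → antiadjacent⇒co-adjacent (u≢v , inj₁ m)) adjacent⇒co-antiadjacent (anti-or-adjacent u≢v))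
        claw-free

      -- Unless its first two vertices form an even pair, an induced path of H can be lengthened.
      path-evenPair : ¬ HasAntihole T → ∀ d {u v vs} → Path u (v ∷ vs) → n T ≤ d + length vs → HasEvenPair T
      path-evenPair ¬antihole zero p n≤ = ⊥-elim (<⇒≱ (<-trans (n<1+n _) (path-length H p)) n≤)
      path-evenPair ¬antihole (suc d) {u} {v} {vs} p@(step uv _ _) n≤ with find-P₄ u v
      ... | no ¬P₄ = u , v , evenPair no-P₆ (proj₁ uv)
        (nonadjacent⇒anti (proj₁ uv) λ a → never-both a (co-adjacent⇒antiadjacent uv)) λ a b q → ¬P₄ (a , b , q)
      ... | yes (a , b , ua , ab , bv , ub , av)
        -- In H the P₄ makes `b` a neighbour of `u` only and `a` a neighbour of `v` only, with `a`
        -- and `b` nonadjacent: they become `w₂` and `w₁`.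
        with lengthen p (antiadjacent⇒co-adjacent (antiadjacent-sym T ub)) (adjacent⇒co-antiadjacent bv)
               (antiadjacent⇒co-adjacent av) (adjacent⇒co-antiadjacent (adjacent-sym T ua)) (adjacent⇒co-antiadjacent ab)
      ...   | inj₁ c = ⊥-elim (¬antihole (cycle⇒hole H c))
      ...   | inj₂ (_ , _ , vs′ , p′ , longer) =
        path-evenPair ¬antihole d p′ (≤-trans n≤ (≤-reflexive (trans (sym (+-suc d _)) (cong (d +_) (sym longer)))))

      edge-evenPair : ¬ HasAntihole T → ∀ {u v} → u ≢ v → StronglyAnti T u v → HasEvenPair T
      edge-evenPair ¬antihole u≢v uv =
        path-evenPair ¬antihole (n T) (step (antiadjacent⇒co-adjacent (u≢v , inj₁ uv)) [] stop) (m≤m+n _ _)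

    module Small {x y} (xy : Semi T x y)
      (no-common : ∀ w → ¬ (Adjacent T x w × Adjacent T y w)) where

      nxy : Antiadjacent T x y
      nxy = proj₁ xy , inj₂ (proj₂ xy)

      -- The common end of x and y has degree 2.
      sole : ∀ s {w} → w ≢ x → w ≢ y → end s x ≡ end s w → end s x ≢ end s y
      sole s w≢x w≢y xw q = no-triangle (proj₁ xy , inj₂ (proj₂ xy)) nxy
        (meet⁺ s (≢-sym w≢x) xw) (meet⁺ s (≢-sym w≢y) (trans (sym q) xw))

      -- In a path u a b v with u, v sharing their end on side s, b meets u and a meets v on the other side.
      other-end : ∀ s {u v b} → end s u ≡ end s v → Antiadjacent T u v → Antiadjacent T u b → Adjacent T b v →
        end (not s) u ≡ end (not s) b
      other-end s q uv ub bv with meet⁻ s ub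
      ... | inj₂ p = p
      ... | inj₁ p = ⊥-elim (no-triangle bv (meet⁺ s (proj₁ bv) (trans (sym p) q)) (antiadjacent-sym T ub) (antiadjacent-sym T uv))

      -- `x` meets `w` at one end, hence `y` at the other, where nothing else meets `x`. In a P₄
      -- `x`, `a`, `b`, `w` the vertex `b` meets `x` there, so `b` is `y`, and `a` would be adjacent
      -- in T to both `x` and `y`.
      beside : ∀ {w} → w ≢ x → w ≢ y → StronglyAnti T x w → IsEvenPair T x w
      beside {w} w≢x w≢y xw = evenPair no-P₆ (≢-sym w≢x) xw ¬P₄
        where
        nxw : Antiadjacent T x w
        nxw = ≢-sym w≢x , inj₁ xw
        through : ∀ s {a b} → end s x ≡ end s w → ¬ P₄ x a b w
        through s {a} {b} q (xa , ab , bw , xb , aw) with meet⁻ s nxy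
        ... | inj₁ p = sole s w≢x w≢y q p
        ... | inj₂ p with b Finₚ.≟ y
        ...   | yes refl = no-common a (xa , adjacent-sym T ab)
        ...   | no b≢y = sole (not s) (≢-sym (proj₁ xb)) b≢y (other-end s q nxw xb bw) p
        ¬P₄ : ∀ a b → ¬ P₄ x a b w
        ¬P₄ a b p = Sum.[ (λ q → through true q p) , (λ q → through false q p) ] (meet⁻ true nxw)

      -- Were `a` strongly antiadjacent to `x`, a common end on side `s` would put the adjacent pair
      -- `u`, `a` in a triangle of H with `w`, and one on the other side would give `w` both ends of
      -- `x`. So `a` is adjacent to `x`, hence not to `y`; and it meets `y` on side `s`, as the
      -- other side would again give `w` both ends of `x`.
      faces-y : ∀ s {u w a} → end s x ≡ end s u → end s x ≡ end s w → end (not s) x ≡ end (not s) y →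
        w ≢ x → StronglyAnti T x u → Antiadjacent T u w → Adjacent T u a → Antiadjacent T a w →
        end (not s) w ≡ end (not s) a → Antiadjacent T a y × end s y ≡ end s a
      faces-y s {u} {w} {a} su sw p w≢x xu uw ua aw wa = meet⁺ s a≢y (sym ya) , ya
        where
        apart : end (not s) x ≢ end (not s) w
        apart q = w≢x (sym (end-injective s sw q))
        a≢x : a ≢ x
        a≢x refl = clash ua (anti-sym xu)
        a≢y : a ≢ y
        a≢y refl = apart (trans p (sym wa))
        ¬xa : ¬ StronglyAnti T x a
        ¬xa xa with meet⁻ s (≢-sym a≢x , inj₁ xa)
        ... | inj₁ q = no-triangle ua (meet⁺ s (proj₁ ua) (trans (sym su) q)) uw aw
        ... | inj₂ q = apart (trans q (sym wa))
        ya : end s y ≡ end s a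
        ya with anti-or-adjacent (≢-sym a≢x) | anti-or-adjacent (≢-sym a≢y)
        ... | inj₁ xa | _ = ⊥-elim (¬xa xa)
        ... | inj₂ xa | inj₂ ya = ⊥-elim (no-common a (xa , ya))
        ... | inj₂ xa | inj₁ m with meet⁻ s (≢-sym a≢y , inj₁ m)
        ...   | inj₁ q = q
        ...   | inj₂ q = ⊥-elim (apart (trans p (trans q (sym wa))))

      -- With `x` the pair forms a triangle of H, so the three share an end and `y` is at the other
      -- end of `x`. Applied from both ends of a P₄, `faces-y` puts the adjacent pair `a`, `b` in a
      -- triangle of H with `y`.
      outside : ∀ {u w} → u ≢ x → u ≢ y → w ≢ x → w ≢ y → StronglyAnti T x u → StronglyAnti T x w →
        u ≢ w → StronglyAnti T u w → IsEvenPair T u w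
      outside {u} {w} u≢x u≢y w≢x w≢y xu xw u≢w uw = evenPair no-P₆ u≢w uw ¬P₄
        where
        nuw : Antiadjacent T u w
        nuw = u≢w , inj₁ uw
        nxu : Antiadjacent T x u
        nxu = ≢-sym u≢x , inj₁ xu
        nxw : Antiadjacent T x w
        nxw = ≢-sym w≢x , inj₁ xw
        nwu : Antiadjacent T w u
        nwu = antiadjacent-sym T nuw
        at-x : ∀ s → end s u ≡ end s w → end s x ≡ end s u
        at-x s q = triangle-end s u≢w q nxu nxw
        through : ∀ s {a b} → end s u ≡ end s w → ¬ P₄ u a b w
        through s {a} {b} q (ua , ab , bw , ub , aw) with meet⁻ s nxy
        ... | inj₁ p = sole s u≢x u≢y (at-x s q) p
        ... | inj₂ p
          with ay , ya ← faces-y s (at-x s q) (trans (at-x s q) q) p w≢x xu nuw ua aw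
                 (other-end s (sym q) nwu (antiadjacent-sym T aw) (adjacent-sym T ua))
             | by , yb ← faces-y s (trans (at-x s q) q) (at-x s q) p u≢x xw nwu (adjacent-sym T bw) (antiadjacent-sym T ub)
                 (other-end s q nuw ub bw)
          = no-triangle ab (meet⁺ s (proj₁ ab) (trans (sym ya) yb)) ay by
        ¬P₄ : ∀ a b → ¬ P₄ u a b w
        ¬P₄ a b p = Sum.[ (λ q → through true q p) , (λ q → through false q p) ] (meet⁻ true nuw)

    small-evenPair : ∀ {x y} → Semi T x y → (∀ w → ¬ (Adjacent T x w × Adjacent T y w)) → Complete T ⊎ HasEvenPair T
    small-evenPair {x} {y} xy no-common = Sum.map₂ even (complete-or-third xy)
      where
      even : (∃ λ w → w ≢ x × w ≢ y) → HasEvenPair T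
      even (w , w≢x , w≢y) with anti-or-adjacent (≢-sym w≢x) | anti-or-adjacent (≢-sym w≢y)
      ... | inj₁ xw | _       = x , w , Small.beside xy no-common w≢x w≢y xw
      ... | inj₂ _  | inj₁ yw = y , w , Small.beside (semi-sym xy) (λ w → no-common w ∘ swap) w≢y w≢x yw
      ... | inj₂ xw | inj₂ yw = ⊥-elim (no-common w (xw , yw))

    small-favorable-evenPair : ∀ {x y} → Semi T x y → (∀ w → ¬ (Adjacent T x w × Adjacent T y w)) →
      Favorable T (small x y) →
      Σ (V T) λ u → Σ (V T) λ v → IsEvenPair T u v × ¬ InD {T} (small x y) u × ¬ InD {T} (small x y) v
    small-favorable-evenPair xy no-common (_ , _ , inj₁ (u , w , ∉u , ∉w , ¬xu , ¬xw , u≢w , ¬uw)) =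
      u , w , Small.outside xy no-common (∉u ∘ inj₁) (∉u ∘ inj₂) (∉w ∘ inj₁) (∉w ∘ inj₂)
        (nonadjacent⇒anti (≢-sym (∉u ∘ inj₁)) ¬xu) (nonadjacent⇒anti (≢-sym (∉w ∘ inj₁)) ¬xw)
        u≢w (nonadjacent⇒anti u≢w ¬uw) , ∉u , ∉w
    small-favorable-evenPair xy no-common (_ , _ , inj₂ (u , w , ∉u , ∉w , ¬yu , ¬yw , u≢w , ¬uw)) =
      u , w , Small.outside (semi-sym xy) (λ w → no-common w ∘ swap) (∉u ∘ inj₂) (∉u ∘ inj₁) (∉w ∘ inj₂) (∉w ∘ inj₁)
        (nonadjacent⇒anti (≢-sym (∉u ∘ inj₂)) ¬yu) (nonadjacent⇒anti (≢-sym (∉w ∘ inj₂)) ¬yw)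
        u≢w (nonadjacent⇒anti u≢w ¬uw) , ∉u , ∉w

-- The cases of the switchable component put together.

no-component : ∀ T → (∀ {u v} → u ≢ v → StronglyAnti T u v → HasEvenPair T) →
  (Complete T ⊎ HasEvenPair T)
  × (Favorable T none → Σ (V T) λ u → Σ (V T) λ v → IsEvenPair T u v × ¬ InD {T} none u × ¬ InD {T} none v)
no-component T even =
  Sum.map₂ (λ (_ , _ , u≢v , uv) → even u≢v uv) (complete-or-anti T) ,
  λ (_ , (_ , _ , u≢w , uw , _) , _) → let u , v , p = even u≢w uw in u , v , p , (λ ()) , (λ ())

theorem4p9 : (T : Trigraph) (s : SwComp T) → InF T s → ¬ HasAntihole T
    → (IsBipartite (complement T) ⊎ IsLineTrigraph (complement T))
    → (Complete T ⊎ HasEvenPair T)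
    × (Favorable T s → Σ (V T) λ u → Σ (V T) λ v → IsEvenPair T u v × ¬ InD s u × ¬ InD s v)
theorem4p9 T none (_ , ¬semi) ¬antihole (inj₁ (f , bip)) =
  no-component T (CoBipartite.edge-evenPair T f bip ¬antihole ¬semi)
theorem4p9 T none (_ , ¬semi) ¬antihole (inj₂ ((_ , _ , e , inj , line) , strong)) =
  no-component T (CoLine.NoSemi.edge-evenPair T e inj line strong ¬semi ¬antihole)
theorem4p9 T (small x y) (_ , xy , only , no-common) ¬antihole (inj₁ (f , bip)) =
  CoBipartite.small-evenPair T f bip xy only no-common ¬antihole ,
  ⊥-elim ∘ CoBipartite.small-unfavorable T f bip
theorem4p9 T (small x y) (_ , xy , _ , no-common) ¬antihole (inj₂ ((_ , _ , e , inj , line) , strong)) =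
  CoLine.small-evenPair T e inj line strong xy no-common ,
  CoLine.small-favorable-evenPair T e inj line strong xy no-common
theorem4p9 T (light v x y) (_ , x≢y , vx , vy , _ , _ , xy , _) _ (inj₁ (f , bip)) =
  ⊥-elim (CoBipartite.no-light T f bip vx vy x≢y xy)
theorem4p9 T (light v x y) (_ , x≢y , vx , vy , _ , _ , xy , _) _ (inj₂ ((_ , _ , e , inj , line) , strong)) =
  ⊥-elim (CoLine.no-light T e inj line strong vx vy x≢y xy)
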